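{- Let $\Gamma$ be a link-regular finite simplicial graph with maximum clique size $d$. Let $\ell_0=|V\Gamma|$ and, for $1\le k\le d$, let $\ell_k=|\mathrm{Lk}(\sigma)|$ for any $k$-clique $\sigma$. For integers $0\le m\le d$ and $0\le k\le m$ set \[ N_{m,k}=\begin{cases}\left(\prod_{k<j<m}\ell_j\right)\sum_{j=k}^{m}\binom{m-k}{j-k}(-1)^{j-k}\ell_j & \text{if } k<m-1,\\ \ell_{m-1}-\ell_m-1 & \text{if } k=m-1,\\ 1 & \text{if } k=m,\end{cases} \] and for integers $0\le i\le d$, $0\le j\le i$ set $M_{i,i}=1$ and, for $i\ne j$, \[ M_{i,j}=\sum_{\substack{j\le s_1<t_1\le s_2<t_2\le\dots\le s_n<t_n\le d\\ (t_1-s_1)+\dots+(t_n-s_n)=i-j}}(-1)^n\binom{t_1}{s_1}\cdots\binom{t_n}{s_n}N_{t_1,s_1}\cdots N_{t_n,s_n} \] (the sum over all $n\ge1$ and all such integer sequences). Then the geodesic growth series of $\mathrm{RACG}(\Gamma)$ is the rational function \[ \mathcal{G}(z)=\frac{\sum_{i=0}^{d}\left(\sum_{j=0}^{i}\ell_0\cdots\ell_{j-1}M_{i,j}\right)z^i}{\sum_{i=0}^{d}M_{i,0}z^i}, \] where $\ell_0\cdots\ell_{j-1}$ is interpreted as $1$ when $j=0$.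
   Context: For a finite simplicial graph $\Gamma$, $\mathrm{RACG}(\Gamma)$ is the right-angled Coxeter group $\langle v\in V\Gamma\mid v^2=1,\ uv=vu \text{ for } \{u,v\}\in E\Gamma\rangle$ with standard generating set $V\Gamma$. A word over $V\Gamma$ is a geodesic if no shorter word represents the same element; the geodesic growth series is $\sum_n a_n z^n$ with $a_n$ the number of geodesic words of length $n$. A $k$-clique is a set of $k$ vertices spanning a complete subgraph; $\mathrm{Lk}(\sigma)=\{v\in V\Gamma\setminus\sigma\mid \sigma\cup\{v\}\text{ is a clique}\}$. $\Gamma$ is link-regular if any two cliques of the same size have links of the same size. -}

module Defs where

import Data.Bool
open import Data.Bool using (Bool; true; false; not; _∧_; _∨_; if_then_else_)
open import Data.Nat as ℕ using (ℕ; zero; suc; _∸_; _≤_; _≡ᵇ_; _<ᵇ_)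
import Data.Nat.Combinatorics as Comb
open import Data.Integer as ℤ using (ℤ; +_; -_; _-_)
open import Data.Fin using (Fin; _≟_)
open import Data.Fin.Subset using (Subset; _∪_; ⁅_⁆; ∣_∣)
open import Data.Vec using (lookup; tabulate)
open import Data.List using (List; []; _∷_; _++_; [_]; length; map; concatMap; upTo; allFin; foldr)
open import Data.Bool.ListAction using (all)
open import Data.List.Relation.Unary.Unique.Propositional using (Unique)
open import Data.List.Membership.Propositional using (_∈_)
open import Data.Product using (Σ; _×_; _,_; proj₁; proj₂)
open import Relation.Nullary using (does)
open import Relation.Binary.PropositionalEquality using (_≡_; _≢_)
open import Relation.Binary.Construct.Closure.Equivalence using (EqClosure)
open import Function.Bundles using (_⇔_)

record SimpleGraph : Set where
  field
    n     : ℕ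
    adj   : Fin n → Fin n → Bool
    sym   : ∀ u v → adj u v ≡ adj v u
    irr   : ∀ v → adj v v ≡ false

module _ (G : SimpleGraph) where
  open SimpleGraph G

  isCliqueᵇ : Subset n → Bool
  isCliqueᵇ σ = all (λ u → all (λ v →
                  not (lookup σ u ∧ lookup σ v) ∨ does (u ≟ v) ∨ adj u v)
                  (allFin n)) (allFin n)

  IsClique : Subset n → Set
  IsClique σ = isCliqueᵇ σ ≡ true

  Lk : Subset n → Subset n
  Lk σ = tabulate (λ v → not (lookup σ v) ∧ isCliqueᵇ (σ ∪ ⁅ v ⁆))

  LinkRegular : Set
  LinkRegular = ∀ σ τ → IsClique σ → IsClique τ → ∣ σ ∣ ≡ ∣ τ ∣ → ∣ Lk σ ∣ ≡ ∣ Lk τ ∣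

  MaxCliqueSize : ℕ → Set
  MaxCliqueSize d = Σ (Subset n) (λ σ → IsClique σ × ∣ σ ∣ ≡ d)
                    × (∀ σ → IsClique σ → ∣ σ ∣ ≤ d)

  -- RACG(Γ): words over VΓ, and equality of the represented elements.
  -- The monoid presentation ⟨ V | vv = 1, uv = vu (u ~ v) ⟩ defines
  -- exactly RACG(Γ) (every generator is an involution).

  Word : Set
  Word = List (Fin n)

  data Step : Word → Word → Set where
    cancel  : ∀ p q v → Step (p ++ v ∷ v ∷ q) (p ++ q)
    commute : ∀ p q u v → adj u v ≡ true → Step (p ++ u ∷ v ∷ q) (p ++ v ∷ u ∷ q)

  _≈_ : Word → Word → Set
  _≈_ = EqClosure Step

  Geodesic : Word → Set
  Geodesic w = ∀ w' → w ≈ w' → length w ≤ length w'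

  GeodesicCount : ℕ → ℕ → Set
  GeodesicCount m k = Σ (List Word) (λ L →
      Unique L
    × (∀ w → (w ∈ L) ⇔ (length w ≡ m × Geodesic w))
    × length L ≡ k)

range : ℕ → ℕ → List ℕ
range a b = map (a ℕ.+_) (upTo (suc b ∸ a))

sumℤ : List ℤ → ℤ
sumℤ = foldr ℤ._+_ (+ 0)

prodℤ : List ℤ → ℤ
prodℤ = foldr ℤ._*_ (+ 1)

module Numbers (ℓ : ℕ → ℕ) (d : ℕ) where

  ℓℤ : ℕ → ℤ
  ℓℤ j = + (ℓ j)

  N : ℕ → ℕ → ℤ
  N m k =
    if suc k <ᵇ m
    then prodℤ (map ℓℤ (range (suc k) (m ∸ 1)))
         ℤ.* sumℤ (map (λ j → + ((m ∸ k) Comb.C (j ∸ k))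
                                ℤ.* ((- + 1) ℤ.^ (j ∸ k)) ℤ.* ℓℤ j)
                        (range k m))
    else if suc k ≡ᵇ m
    then ℓℤ k - ℓℤ m - + 1
    else + 1

  -- all sequences j ≤ s₁ < t₁ ≤ s₂ < t₂ ≤ … ≤ sₙ < tₙ ≤ d (n ≥ 0),
  -- as lists of pairs (sᵢ , tᵢ); the fuel bounds n (n ≤ d always).
  chains : ℕ → ℕ → List (List (ℕ × ℕ))
  chains zero    j = [ [] ]
  chains (suc f) j = [] ∷ concatMap (λ s → concatMap (λ t →
                        map ((s , t) ∷_) (chains f t))
                        (range (suc s) d)) (range j d)

  total : List (ℕ × ℕ) → ℕ
  total = foldr (λ p r → (proj₂ p ∸ proj₁ p) ℕ.+ r) 0

  nonEmpty : List (ℕ × ℕ) → Bool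
  nonEmpty [] = false
  nonEmpty (_ ∷ _) = true

  weight : List (ℕ × ℕ) → ℤ
  weight = foldr (λ p r → (- + 1) ℤ.* + (proj₂ p Comb.C proj₁ p)
                          ℤ.* N (proj₂ p) (proj₁ p) ℤ.* r) (+ 1)

  M : ℕ → ℕ → ℤ
  M i j = if i ≡ᵇ j then + 1
          else sumℤ (map (λ c → if nonEmpty c ∧ (total c ≡ᵇ (i ∸ j))
                                then weight c else + 0)
                      (chains (suc d) j))

  numCoeff : ℕ → ℤ
  numCoeff i = if i ℕ.≤ᵇ d
               then sumℤ (map (λ j → prodℤ (map ℓℤ (upTo j)) ℤ.* M i j) (range 0 i))
               else + 0

  denCoeff : ℕ → ℤ
  denCoeff i = if i ℕ.≤ᵇ d then M i 0 else + 0

Series : Set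
Series = ℕ → ℤ

_*ₛ_ : Series → Series → Series
(f *ₛ g) m = sumℤ (map (λ i → f i ℤ.* g (m ∸ i)) (range 0 m))

{-
A word v ∷ w with w geodesic is geodesic iff v cannot be shuffled to the front of w, and the letters
that can be form a clique, the set of initial letters of w. If this clique σ has k elements, the
initial letters of v ∷ w are v and the neighbours of v in σ. The number of v ∉ σ with j neighbours
in σ follows from the link sizes by inclusion-exclusion, so it depends only on k, and the series X k
counting the geodesic extensions of w satisfy a triangular-plus-superdiagonal linear system. After
scaling by U k = ℓ₀⋯ℓₖ₋₁ zᵏ X k it reads

  U k = ℓ₀⋯ℓₖ₋₁ zᵏ + U (k+1) + Σ_{j<k} C(k,j) N_{k,j} zᵏ⁻ʲ U (j+1),

with U (d+1) = 0 because ℓ_d = 0. Let D j = Σ_i M_{i,j} zⁱ⁻ʲ, the generating polynomial of the chains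
that start at j or later. Splitting off the chains whose first link starts at j gives
D (j+1) = D j + Σ_{k>j} C(k,j) N_{k,j} zᵏ⁻ʲ D k, so in Σ_k D k U k, rewritten by the system,
everything telescopes except D 0 U 0 = Σ_k ℓ₀⋯ℓₖ₋₁ zᵏ D k.
-}
module Submission where

open import Defs
import Data.Integer
open import Data.Nat using (ℕ; _≤_)
open import Data.Fin.Subset using (∣_∣)
open import Relation.Binary.PropositionalEquality using (_≡_)

open import Algebra.Bundles using (AbelianGroup)
import Algebra.Properties.Group
import Data.Bool as Bool
open import Data.Bool using (Bool; true; false; not; _∧_; _∨_; if_then_else_)
open import Data.Bool.ListAction using (all)
import Data.Bool.Properties as Boolₚ
open import Data.Empty using (⊥; ⊥-elim)
open import Data.Fin as Fin using (Fin; _≟_)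
open import Data.Fin.Subset using (Subset; _∪_; ⁅_⁆; _⊂_; Empty) renaming (⊥ to ⊥ₛ)
import Data.Fin.Subset.Properties as Subset
open import Data.Integer using (ℤ; +_; -_; _+_; _*_; _-_; _^_)
import Data.Integer.Properties as ℤₚ
open import Data.Integer.Tactic.RingSolver using (solve-∀)
open import Data.List
  using (List; []; _∷_; _++_; length; map; concatMap; filter; allFin; upTo; applyUpTo; tabulate; cartesianProductWith)
open import Data.List.Membership.Propositional using (_∈_; _∉_)
open import Data.List.Membership.Propositional.Properties
  using (∈-filter⁺; ∈-filter⁻; ∈-cartesianProductWith⁺; ∈-cartesianProductWith⁻; ∈-allFin)
open import Data.List.Membership.Propositional.Properties.WithK using (unique∧set⇒bag)
import Data.List.Membership.DecPropositional as DecMembership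
import Data.List.Properties as List
open import Data.List.Relation.Binary.BagAndSetEquality using (∼bag⇒↭)
open import Data.List.Relation.Binary.Permutation.Propositional.Properties using (↭-length)
open import Data.List.Relation.Unary.All as All using (All; []; _∷_)
import Data.List.Relation.Unary.All.Properties as Allₚ
open import Data.List.Relation.Unary.AllPairs as AllPairs using (AllPairs; []; _∷_)
import Data.List.Relation.Unary.AllPairs.Properties as AllPairsₚ
open import Data.List.Relation.Unary.Any using (here; there)
open import Data.List.Relation.Unary.Unique.Propositional using (Unique)
import Data.List.Relation.Unary.Unique.Propositional.Properties as Unique
open import Data.Nat as ℕ using (zero; suc; _∸_; _<_; _≡ᵇ_; _<ᵇ_; z≤n; s≤s)
open import Data.Nat.Combinatorics using (_C_; nCk+nC[k+1]≡[n+1]C[k+1]; k>n⇒nCk≡0; nCn≡1; nC1≡n; nCk≡nC[n∸k])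
import Data.Nat.Properties as ℕₚ
open import Data.Product using (∃; _×_; _,_; proj₁; proj₂)
open import Data.Sum using (_⊎_; inj₁; inj₂)
open import Data.Vec using (lookup)
import Data.Vec as Vec
open import Data.Vec.Properties using (lookup∘tabulate; []=⇒lookup; lookup⇒[]=)
open import Function using (_∘_; id; case_of_)
open import Function.Bundles using (_⇔_; mk⇔)
import Function.Properties.Equivalence as ⇔
open import Relation.Binary.Construct.Closure.ReflexiveTransitive using (ε; _◅_; _◅◅_; gmap)
import Relation.Binary.Construct.Closure.Symmetric as Sym
open Sym using (fwd; bwd)
open import Relation.Binary.PropositionalEquality using (_≢_; refl; sym; trans; cong; cong₂; subst; module ≡-Reasoning)
open import Relation.Nullary using (¬_; Dec; yes; no; does; ¬?)
open import Relation.Nullary.Decidable using (dec-true; dec-false)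
open import Relation.Unary using (Decidable)

open Algebra.Properties.Group (AbelianGroup.group ℤₚ.+-0-abelianGroup) using (∙-cancelʳ)
open ≡-Reasoning

-- `Geodesic` quantifies over all equal words, so it cannot be counted directly. It is replaced by a
-- condition on one letter at a time: each letter acts on reduced words, cancelling if it can be
-- shuffled to the front and being prepended otherwise. This action satisfies the relations of the
-- group only up to commutation of letters, which suffices because commutations preserve length. The
-- scaling by ℓ₀⋯ℓₖ₋₁ is dictated by `N`: the product of link sizes in `N k j` is what the factor
-- for k has beyond the factor for j + 1. Nothing is divided, and the factor ℓ_d = 0 closes the
-- system at d + 1, where there are no cliques left for `extensions` to speak of. The polynomials D
-- j are represented by operators on series, so that the telescoping uses linearity and commutation
-- with powers of z in place of products of series; a product appears only where `denCoeff` is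
-- compared with D 0.

private variable
  A B E : Set

-- Sums over lists

+-congˡ : ∀ x {y z} → y ≡ z → x + y ≡ x + z
+-congˡ x = cong (λ y → x + y)

⟦_⟧ : Bool → ℤ
⟦ b ⟧ = if b then + 1 else + 0

opaque
  -- Opaque, so that a sum stays one term with a recognisable summand; `∑-unfold` is the passage to
  -- the sums in the definitions.
  ∑ : List A → (A → ℤ) → ℤ
  ∑ xs f = sumℤ (map f xs)

  ∑-unfold : ∀ (xs : List A) (f : A → ℤ) → ∑ xs f ≡ sumℤ (map f xs)
  ∑-unfold xs f = refl

  ∑-[] : ∀ (f : A → ℤ) → ∑ [] f ≡ + 0
  ∑-[] f = refl

  ∑-∷ : ∀ x (xs : List A) (f : A → ℤ) → ∑ (x ∷ xs) f ≡ f x + ∑ xs f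
  ∑-∷ x xs f = refl

  ∑-cong-∈ : ∀ (xs : List A) {f g : A → ℤ} → (∀ x → x ∈ xs → f x ≡ g x) → ∑ xs f ≡ ∑ xs g
  ∑-cong-∈ []       p = refl
  ∑-cong-∈ (x ∷ xs) p = cong₂ _+_ (p x (here refl)) (∑-cong-∈ xs λ y → p y ∘ there)

  ∑-cong : ∀ (xs : List A) {f g : A → ℤ} → (∀ x → f x ≡ g x) → ∑ xs f ≡ ∑ xs g
  ∑-cong xs p = ∑-cong-∈ xs λ x _ → p x

  ∑-zero : ∀ (xs : List A) → ∑ xs (λ _ → + 0) ≡ + 0
  ∑-zero []       = refl
  ∑-zero (x ∷ xs) = trans (ℤₚ.+-identityˡ _) (∑-zero xs)

  ∑-+ : ∀ (xs : List A) (f g : A → ℤ) → ∑ xs (λ x → f x + g x) ≡ ∑ xs f + ∑ xs g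
  ∑-+ []       f g = refl
  ∑-+ (x ∷ xs) f g rewrite ∑-+ xs f g = lemma (f x) (g x) _ _
    where
    lemma : ∀ a b c d → (a + b) + (c + d) ≡ (a + c) + (b + d)
    lemma = solve-∀

  ∑-*ˡ : ∀ (xs : List A) c (f : A → ℤ) → ∑ xs (λ x → c * f x) ≡ c * ∑ xs f
  ∑-*ˡ []       c f = sym (ℤₚ.*-zeroʳ c)
  ∑-*ˡ (x ∷ xs) c f rewrite ∑-*ˡ xs c f = sym (ℤₚ.*-distribˡ-+ c (f x) _)

  ∑-*ʳ : ∀ (xs : List A) c (f : A → ℤ) → ∑ xs (λ x → f x * c) ≡ ∑ xs f * c
  ∑-*ʳ xs c f = begin
    ∑ xs (λ x → f x * c) ≡⟨ ∑-cong xs (λ x → ℤₚ.*-comm (f x) c) ⟩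
    ∑ xs (λ x → c * f x) ≡⟨ ∑-*ˡ xs c f ⟩
    c * ∑ xs f           ≡⟨ ℤₚ.*-comm c _ ⟩
    ∑ xs f * c           ∎

  ∑-neg : ∀ (xs : List A) (f : A → ℤ) → ∑ xs (λ x → - f x) ≡ - ∑ xs f
  ∑-neg []       f = refl
  ∑-neg (x ∷ xs) f rewrite ∑-neg xs f = sym (ℤₚ.neg-distrib-+ (f x) _)

  ∑-- : ∀ (xs : List A) (f g : A → ℤ) → ∑ xs (λ x → f x - g x) ≡ ∑ xs f - ∑ xs g
  ∑-- xs f g = trans (∑-+ xs f (λ x → - g x)) (+-congˡ (∑ xs f) (∑-neg xs g))

  ∑-const : ∀ (xs : List A) c → ∑ xs (λ _ → c) ≡ + length xs * c
  ∑-const []       c = refl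
  ∑-const (x ∷ xs) c rewrite ∑-const xs c = sym (ℤₚ.suc-* (+ length xs) c)

  ∑-comm : ∀ (xs : List A) (ys : List B) (f : A → B → ℤ) →
           ∑ xs (λ x → ∑ ys (f x)) ≡ ∑ ys (λ y → ∑ xs (λ x → f x y))
  ∑-comm []       ys f = sym (∑-zero ys)
  ∑-comm (x ∷ xs) ys f rewrite ∑-comm xs ys f = sym (∑-+ ys (f x) _)

  ∑-++ : ∀ (xs ys : List A) (f : A → ℤ) → ∑ (xs ++ ys) f ≡ ∑ xs f + ∑ ys f
  ∑-++ []       ys f = sym (ℤₚ.+-identityˡ _)
  ∑-++ (x ∷ xs) ys f rewrite ∑-++ xs ys f = sym (ℤₚ.+-assoc (f x) _ _)

  ∑-map : ∀ (g : A → B) xs (f : B → ℤ) → ∑ (map g xs) f ≡ ∑ xs (f ∘ g)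
  ∑-map g xs f = cong sumℤ (sym (List.map-∘ xs))

  ∑-concatMap : ∀ (g : A → List B) xs (f : B → ℤ) → ∑ (concatMap g xs) f ≡ ∑ xs (λ x → ∑ (g x) f)
  ∑-concatMap g []       f = refl
  ∑-concatMap g (x ∷ xs) f = trans (∑-++ (g x) _ f) (+-congˡ (∑ (g x) f) (∑-concatMap g xs f))

  ∑-cartesianProductWith : ∀ (g : A → B → E) xs ys (f : E → ℤ) →
    ∑ (cartesianProductWith g xs ys) f ≡ ∑ xs (λ x → ∑ ys (λ y → f (g x y)))
  ∑-cartesianProductWith g []       ys f = refl
  ∑-cartesianProductWith g (x ∷ xs) ys f = trans (∑-++ (map (g x) ys) _ f)
    (cong₂ _+_ (∑-map (g x) ys f) (∑-cartesianProductWith g xs ys f))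

  ∑-filter : ∀ {P : A → Set} (P? : Decidable P) xs (f : A → ℤ) →
             ∑ (filter P? xs) f ≡ ∑ xs (λ x → ⟦ does (P? x) ⟧ * f x)
  ∑-filter P? []       f = refl
  ∑-filter P? (x ∷ xs) f with does (P? x)
  ... | true  = cong₂ _+_ (sym (ℤₚ.*-identityˡ (f x))) (∑-filter P? xs f)
  ... | false = trans (∑-filter P? xs f) (sym (ℤₚ.+-identityˡ _))

  ∑-upTo-suc : ∀ n (f : ℕ → ℤ) → ∑ (upTo (suc n)) f ≡ f 0 + ∑ (upTo n) (f ∘ suc)
  ∑-upTo-suc n f = cong (λ xs → f 0 + sumℤ xs) (begin
    map f (applyUpTo suc n)    ≡⟨ List.map-applyUpTo suc f n ⟩
    applyUpTo (f ∘ suc) n      ≡⟨ List.map-upTo (f ∘ suc) n ⟨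
    map (f ∘ suc) (upTo n)     ∎)

  ∑-upTo-last : ∀ n (f : ℕ → ℤ) → ∑ (upTo (suc n)) f ≡ ∑ (upTo n) f + f n
  ∑-upTo-last n f = begin
    ∑ (upTo (suc n)) f          ≡⟨ cong (λ xs → ∑ xs f) (List.upTo-∷ʳ n) ⟨
    ∑ (upTo n ++ n ∷ []) f      ≡⟨ ∑-++ (upTo n) (n ∷ []) f ⟩
    ∑ (upTo n) f + (f n + + 0)  ≡⟨ +-congˡ (∑ (upTo n) f) (ℤₚ.+-identityʳ (f n)) ⟩
    ∑ (upTo n) f + f n          ∎

  ∑-upTo-cong : ∀ n {f g : ℕ → ℤ} → (∀ i → i < n → f i ≡ g i) → ∑ (upTo n) f ≡ ∑ (upTo n) g
  ∑-upTo-cong zero    p = refl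
  ∑-upTo-cong (suc n) {f} {g} p = begin
    ∑ (upTo (suc n)) f           ≡⟨ ∑-upTo-suc n f ⟩
    f 0 + ∑ (upTo n) (f ∘ suc)   ≡⟨ cong₂ _+_ (p 0 (s≤s z≤n)) (∑-upTo-cong n λ i i<n → p (suc i) (s≤s i<n)) ⟩
    g 0 + ∑ (upTo n) (g ∘ suc)   ≡⟨ ∑-upTo-suc n g ⟨
    ∑ (upTo (suc n)) g           ∎

∑-range : ∀ a b (f : ℕ → ℤ) → ∑ (range a b) f ≡ ∑ (upTo (suc b ∸ a)) (λ i → f (a ℕ.+ i))
∑-range a b f = ∑-map (a ℕ.+_) (upTo (suc b ∸ a)) f

∑-range-empty : ∀ {a b} (f : ℕ → ℤ) → b < a → ∑ (range a b) f ≡ + 0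
∑-range-empty {a} {b} f b<a rewrite ∑-range a b f | ℕₚ.m≤n⇒m∸n≡0 b<a = ∑-[] _

∑-range-first : ∀ {a b} (f : ℕ → ℤ) → a ≤ b → ∑ (range a b) f ≡ f a + ∑ (range (suc a) b) f
∑-range-first {a} {b} f a≤b = begin
  ∑ (range a b) f                                            ≡⟨ ∑-range a b f ⟩
  ∑ (upTo (suc b ∸ a)) (λ i → f (a ℕ.+ i))                   ≡⟨ cong (λ m → ∑ (upTo m) (λ i → f (a ℕ.+ i))) (ℕₚ.+-∸-assoc 1 a≤b) ⟩
  ∑ (upTo (suc (b ∸ a))) (λ i → f (a ℕ.+ i))                 ≡⟨ ∑-upTo-suc (b ∸ a) (λ i → f (a ℕ.+ i)) ⟩
  f (a ℕ.+ 0) + ∑ (upTo (b ∸ a)) (λ i → f (a ℕ.+ suc i))     ≡⟨ cong₂ _+_ (cong f (ℕₚ.+-identityʳ a)) (∑-cong (upTo (b ∸ a)) λ i → cong f (ℕₚ.+-suc a i)) ⟩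
  f a + ∑ (upTo (b ∸ a)) (λ i → f (suc a ℕ.+ i))             ≡⟨ +-congˡ (f a) (∑-range (suc a) b f) ⟨
  f a + ∑ (range (suc a) b) f                                ∎

∑-triangle : ∀ n (f : ℕ → ℕ → ℤ) →
  ∑ (upTo (suc n)) (λ k → ∑ (upTo k) (f k)) ≡
  ∑ (upTo (suc n)) (λ j → ∑ (range (suc j) n) (λ k → f k j))
∑-triangle zero    f = begin
  ∑ (upTo 1) (λ k → ∑ (upTo k) (f k))                ≡⟨ ∑-∷ 0 [] _ ⟩
  ∑ [] (f 0) + ∑ [] (λ k → ∑ (upTo k) (f k))         ≡⟨ cong₂ _+_ (trans (∑-[] _) (sym (∑-[] _))) (trans (∑-[] _) (sym (∑-[] _))) ⟩
  ∑ (range 1 0) (λ k → f k 0) + ∑ [] (λ j → ∑ (range (suc j) 0) (λ k → f k j)) ≡⟨ ∑-∷ 0 [] (λ j → ∑ (range (suc j) 0) (λ k → f k j)) ⟨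
  ∑ (upTo 1) (λ j → ∑ (range (suc j) 0) (λ k → f k j)) ∎
∑-triangle (suc n) f = begin
  ∑ (upTo (2 ℕ.+ n)) (λ k → ∑ (upTo k) (f k))
    ≡⟨ trans (∑-upTo-suc (suc n) (λ k → ∑ (upTo k) (f k))) (cong₂ _+_ (∑-[] (f 0)) refl) ⟩
  + 0 + ∑ (upTo (suc n)) (λ k → ∑ (upTo (suc k)) (f (suc k)))
    ≡⟨ ℤₚ.+-identityˡ _ ⟩
  ∑ (upTo (suc n)) (λ k → ∑ (upTo (suc k)) (f (suc k)))
    ≡⟨ ∑-cong (upTo (suc n)) (λ k → ∑-upTo-suc k (f (suc k))) ⟩
  ∑ (upTo (suc n)) (λ k → f (suc k) 0 + ∑ (upTo k) (f (suc k) ∘ suc))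
    ≡⟨ ∑-+ (upTo (suc n)) _ _ ⟩
  ∑ (upTo (suc n)) (λ k → f (suc k) 0) + ∑ (upTo (suc n)) (λ k → ∑ (upTo k) (f (suc k) ∘ suc))
    ≡⟨ cong₂ _+_ (sym (∑-range 1 (suc n) _)) (∑-triangle n (λ k j → f (suc k) (suc j))) ⟩
  ∑ (range 1 (suc n)) (λ k → f k 0) + ∑ (upTo (suc n)) (λ j → ∑ (range (suc j) n) (λ k → f (suc k) (suc j)))
    ≡⟨ +-congˡ (∑ (range 1 (suc n)) (λ k → f k 0)) (∑-cong (upTo (suc n)) λ j → trans (∑-range (suc j) n _) (sym (∑-range (2 ℕ.+ j) (suc n) _))) ⟩
  ∑ (range 1 (suc n)) (λ k → f k 0) + ∑ (upTo (suc n)) (λ j → ∑ (range (2 ℕ.+ j) (suc n)) (λ k → f k (suc j)))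
    ≡⟨ ∑-upTo-suc (suc n) (λ j → ∑ (range (suc j) (suc n)) (λ k → f k j)) ⟨
  ∑ (upTo (2 ℕ.+ n)) (λ j → ∑ (range (suc j) (suc n)) (λ k → f k j)) ∎

-- With E the operator `h ↦ h ∘ suc`, this is the value of (1 + E)ᵏ h at 0; `binomialSum-suc` takes
-- out one factor 1 + E.
binomialSum : ℕ → (ℕ → ℤ) → ℤ
binomialSum k h = ∑ (upTo (suc k)) (λ j → + (k C j) * h j)

binomialSum-suc : ∀ k h → binomialSum (suc k) h ≡ binomialSum k h + binomialSum k (h ∘ suc)
binomialSum-suc k h = begin
  binomialSum (suc k) h
    ≡⟨ ∑-upTo-suc (suc k) (λ j → + (suc k C j) * h j) ⟩
  + 1 * h 0 + ∑ (upTo (suc k)) (λ j → + (suc k C suc j) * h (suc j))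
    ≡⟨ +-congˡ (+ 1 * h 0) (∑-cong (upTo (suc k)) λ j → pascal j) ⟩
  + 1 * h 0 + ∑ (upTo (suc k)) (λ j → + (k C j) * h (suc j) + + (k C suc j) * h (suc j))
    ≡⟨ +-congˡ (+ 1 * h 0) (∑-+ (upTo (suc k)) _ _) ⟩
  + 1 * h 0 + (binomialSum k (h ∘ suc) + ∑ (upTo (suc k)) (λ j → + (k C suc j) * h (suc j)))
    ≡⟨ rearrange (+ 1 * h 0) (binomialSum k (h ∘ suc)) _ ⟩
  (+ 1 * h 0 + ∑ (upTo (suc k)) (λ j → + (k C suc j) * h (suc j))) + binomialSum k (h ∘ suc)
    ≡⟨ cong (_+ binomialSum k (h ∘ suc)) (∑-upTo-suc (suc k) (λ j → + (k C j) * h j)) ⟨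
  ∑ (upTo (2 ℕ.+ k)) (λ j → + (k C j) * h j) + binomialSum k (h ∘ suc)
    ≡⟨ cong (_+ binomialSum k (h ∘ suc)) (∑-upTo-last (suc k) (λ j → + (k C j) * h j)) ⟩
  (binomialSum k h + + (k C suc k) * h (suc k)) + binomialSum k (h ∘ suc)
    ≡⟨ cong (λ c → (binomialSum k h + + c * h (suc k)) + binomialSum k (h ∘ suc)) (k>n⇒nCk≡0 (ℕₚ.n<1+n k)) ⟩
  (binomialSum k h + + 0 * h (suc k)) + binomialSum k (h ∘ suc)
    ≡⟨ cong (_+ binomialSum k (h ∘ suc)) (ℤₚ.+-identityʳ (binomialSum k h)) ⟩
  binomialSum k h + binomialSum k (h ∘ suc) ∎
  where
  pascal : ∀ j → + (suc k C suc j) * h (suc j) ≡ + (k C j) * h (suc j) + + (k C suc j) * h (suc j)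
  pascal j = trans (cong (λ c → + c * h (suc j)) (sym (nCk+nC[k+1]≡[n+1]C[k+1] k j)))
                   (ℤₚ.*-distribʳ-+ (h (suc j)) (+ (k C j)) (+ (k C suc j)))
  rearrange : ∀ a b c → a + (b + c) ≡ (a + c) + b
  rearrange = solve-∀

-- Reduced words

module Words (Γ : SimpleGraph) where
  open SimpleGraph Γ using (n; adj; irr) renaming (sym to adj-sym)
  open DecMembership {A = Fin n} _≟_ using (_∈?_)

  private
    W = List (Fin n)

  Adj : Fin n → Fin n → Set
  Adj u v = adj u v ≡ true

  Adj-sym : ∀ {u v} → Adj u v → Adj v u
  Adj-sym {u} {v} p = trans (adj-sym v u) p

  Adj-irr : ∀ {v} → ¬ Adj v v
  Adj-irr {v} p with trans (sym p) (irr v)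
  ... | ()

  adj? : ∀ u v → Dec (Adj u v)
  adj? u v = adj u v Bool.≟ true

  -- A letter of `w` reaches the front of `v ∷ w` only by passing `v`, hence the filter. A copy of
  -- `v` in `initials w` is dropped because `adj` is irreflexive, so the list is a clique without
  -- repetitions even if the word is not reduced.
  initials : W → W
  initials []      = []
  initials (v ∷ w) = v ∷ filter (adj? v) (initials w)

  data Reduced : W → Set where
    []  : Reduced []
    _∷_ : ∀ {v w} → v ∉ initials w → Reduced w → Reduced (v ∷ w)

  initials-clique : ∀ w → AllPairs Adj (initials w)
  initials-clique []      = []
  initials-clique (v ∷ w) =
    Allₚ.all-filter (adj? v) (initials w) ∷ AllPairsₚ.filter⁺ (adj? v) (initials-clique w)

  -- Del v w w′: the letter v can be shuffled to the front of w, leaving w′.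
  data Del (v : Fin n) : W → W → Set where
    here  : ∀ {w} → Del v (v ∷ w) w
    there : ∀ {u w w′} → Adj u v → Del v w w′ → Del v (u ∷ w) (u ∷ w′)

  ∈initials⇒Del : ∀ {v} w → v ∈ initials w → ∃ (Del v w)
  ∈initials⇒Del (u ∷ w) (here refl) = w , here
  ∈initials⇒Del (u ∷ w) (there p) with ∈-filter⁻ (adj? u) p
  ... | q , a with ∈initials⇒Del w q
  ... | w′ , d = u ∷ w′ , there a d

  Del⇒∈initials : ∀ {v w w′} → Del v w w′ → v ∈ initials w
  Del⇒∈initials here        = here refl
  Del⇒∈initials (there {u} a d) = there (∈-filter⁺ (adj? u) (Del⇒∈initials d) a)

  -- A letter is not adjacent to itself, so it cannot pass an earlier copy of itself: only the first
  -- occurrence can be shuffled out.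
  Del-unique : ∀ {v w a b} → Del v w a → Del v w b → a ≡ b
  Del-unique here        here        = refl
  Del-unique here        (there p _) = ⊥-elim (Adj-irr p)
  Del-unique (there p _) here        = ⊥-elim (Adj-irr p)
  Del-unique (there _ d) (there _ e) = cong (_ ∷_) (Del-unique d e)

  infix 4 _~_
  -- Equality in the trace monoid: commutations alone, without cancellation.
  data _~_ : W → W → Set where
    ~-refl  : ∀ {w} → w ~ w
    ~-trans : ∀ {w x y} → w ~ x → x ~ y → w ~ y
    ~-cons  : ∀ {u w x} → w ~ x → u ∷ w ~ u ∷ x
    ~-swap  : ∀ {u v w} → Adj u v → u ∷ v ∷ w ~ v ∷ u ∷ w

  ~-sym : ∀ {w x} → w ~ x → x ~ w
  ~-sym ~-refl        = ~-refl
  ~-sym (~-trans p q) = ~-trans (~-sym q) (~-sym p)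
  ~-sym (~-cons p)    = ~-cons (~-sym p)
  ~-sym (~-swap a)    = ~-swap (Adj-sym a)

  ~-length : ∀ {w x} → w ~ x → length w ≡ length x
  ~-length ~-refl        = refl
  ~-length (~-trans p q) = trans (~-length p) (~-length q)
  ~-length (~-cons p)    = cong suc (~-length p)
  ~-length (~-swap _)    = refl

  Del⇒~ : ∀ {v w w′} → Del v w w′ → w ~ v ∷ w′
  Del⇒~ here        = ~-refl
  Del⇒~ (there a d) = ~-trans (~-cons (Del⇒~ d)) (~-swap a)

  Del-resp-~ : ∀ {v w x w′} → w ~ x → Del v w w′ → ∃ λ x′ → Del v x x′ × w′ ~ x′
  Del-resp-~ ~-refl d = _ , d , ~-refl
  Del-resp-~ (~-trans p q) d with Del-resp-~ p d
  ... | _ , d′ , r with Del-resp-~ q d′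
  ... | _ , d″ , s = _ , d″ , ~-trans r s
  Del-resp-~ (~-cons p) here = _ , here , p
  Del-resp-~ (~-cons p) (there a d) with Del-resp-~ p d
  ... | _ , d′ , r = _ , there a d′ , ~-cons r
  Del-resp-~ (~-swap a) here                    = _ , there (Adj-sym a) here , ~-refl
  Del-resp-~ (~-swap a) (there b here)          = _ , here , ~-refl
  Del-resp-~ (~-swap a) (there b (there c d))   = _ , there c (there b d) , ~-swap a

  -- Left multiplication by `v`. As a relation it exposes the two outcomes to case analysis; `act`
  -- supplies the function.
  Act : Fin n → W → W → Set
  Act v w w′ = Del v w w′ ⊎ (¬ ∃ (Del v w) × w′ ≡ v ∷ w)

  Act-resp-~ : ∀ {v w x w′ x′} → w ~ x → Act v w w′ → Act v x x′ → w′ ~ x′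
  Act-resp-~ p (inj₁ d) (inj₁ e) with Del-resp-~ p d
  ... | _ , d′ , r = subst (_ ~_) (Del-unique d′ e) r
  Act-resp-~ p (inj₁ d) (inj₂ (ne , _)) with Del-resp-~ p d
  ... | _ , d′ , _ = ⊥-elim (ne (_ , d′))
  Act-resp-~ p (inj₂ (ne , _)) (inj₁ e) with Del-resp-~ (~-sym p) e
  ... | _ , e′ , _ = ⊥-elim (ne (_ , e′))
  Act-resp-~ p (inj₂ (_ , refl)) (inj₂ (_ , refl)) = ~-cons p

  Reduced⇒¬Del² : ∀ {v w a b} → Reduced w → Del v w a → ¬ Del v a b
  Reduced⇒¬Del² (v∉ ∷ r) here        e           = v∉ (Del⇒∈initials e)
  Reduced⇒¬Del² (_ ∷ r)  (there p d) here        = Adj-irr p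
  Reduced⇒¬Del² (_ ∷ r)  (there p d) (there _ e) = Reduced⇒¬Del² r d e

  Del-Reduced : ∀ {v w a} → Reduced w → Del v w a → Reduced a
  Del-Reduced (_ ∷ r)  here = r
  Del-Reduced {v} (u∉ ∷ r) (there {u} {w} {w′} p d) = u∉′ ∷ Del-Reduced r d
    where
    u∉′ : u ∉ initials w′
    -- `u` is adjacent to `v`, so from the front of `w′` it could move on to the front of `v ∷ w′`,
    -- which is `w` up to commutation.
    u∉′ i with ∈initials⇒Del w′ i
    ... | _ , e with Del-resp-~ (~-sym (Del⇒~ d)) (there (Adj-sym p) e)
    ... | _ , e′ , _ = u∉ (Del⇒∈initials e′)

  Act-Reduced : ∀ {v w w′} → Reduced w → Act v w w′ → Reduced w′
  Act-Reduced r (inj₁ d)           = Del-Reduced r d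
  Act-Reduced {w = w} r (inj₂ (ne , refl)) = (ne ∘ ∈initials⇒Del w) ∷ r

  -- The relation v² = 1 for the action. Reducedness excludes two deletions of `v` in a row, which
  -- would leave a word shorter than `r`.
  Act-involutive : ∀ {v r s t} → Reduced r → Act v r s → Act v s t → t ~ r
  Act-involutive red (inj₁ d) (inj₁ e)          = ⊥-elim (Reduced⇒¬Del² red d e)
  Act-involutive red (inj₁ d) (inj₂ (_ , refl)) = ~-sym (Del⇒~ d)
  Act-involutive red (inj₂ (_ , refl)) (inj₁ e) with Del-unique e here
  ... | refl = ~-refl
  Act-involutive red (inj₂ (_ , refl)) (inj₂ (ne , _)) = ⊥-elim (ne (_ , here))

  Del-∷⁻ : ∀ {u v w a} → Adj u v → Del v (u ∷ w) a → ∃ (Del v w)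
  Del-∷⁻ p here        = ⊥-elim (Adj-irr p)
  Del-∷⁻ p (there _ d) = _ , d

  -- The relation uv = vu for the action. Since the letters are adjacent, prepending or deleting one
  -- does not change whether the other can be deleted, so both orders make the same two moves.
  Act-comm : ∀ {u v r r₁ r₂ s₁ s₂} → Adj u v →
             Act u r r₁ → Act v r₁ r₂ → Act v r s₁ → Act u s₁ s₂ → r₂ ~ s₂
  Act-comm p (inj₂ (nu , refl)) a (inj₂ (nv , refl)) b = ~-trans (lemma p nv a) (~-trans (~-swap (Adj-sym p)) (~-sym (lemma (Adj-sym p) nu b)))
    where
    lemma : ∀ {u v r r₂} → Adj u v → ¬ ∃ (Del v r) → Act v (u ∷ r) r₂ → r₂ ~ v ∷ u ∷ r
    lemma p nv (inj₁ d)          = ⊥-elim (nv (Del-∷⁻ p d))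
    lemma p nv (inj₂ (_ , refl)) = ~-refl
  Act-comm p (inj₁ d) a (inj₁ e) b with Del-resp-~ (Del⇒~ d) e
  ... | _ , here , _       = ⊥-elim (Adj-irr p)
  ... | _ , there q f , s~ =
    ~-trans (Act-resp-~ ~-refl a (inj₁ f)) (~-sym (Act-resp-~ s~ b (inj₁ here)))
  Act-comm p (inj₁ d) a (inj₂ (nv , refl)) b = mixed p d a nv b
    where
    mixed : ∀ {u v r r₁ r₂ s₂} → Adj u v → Del u r r₁ → Act v r₁ r₂ →
            ¬ ∃ (Del v r) → Act u (v ∷ r) s₂ → r₂ ~ s₂
    mixed p d (inj₁ e) nv b with Del-resp-~ (~-sym (Del⇒~ d)) (there p e)
    ... | _ , e′ , _ = ⊥-elim (nv (_ , e′))
    mixed p d (inj₂ (_ , refl)) nv b = Act-resp-~ ~-refl (inj₁ (there (Adj-sym p) d)) b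
  Act-comm p (inj₂ (nu , refl)) a (inj₁ e) b =
    ~-sym (Act-comm (Adj-sym p) (inj₁ e) b (inj₂ (nu , refl)) a)

  act : ∀ v w → ∃ (Act v w)
  act v w with v ∈? initials w
  ... | yes p = proj₁ (∈initials⇒Del w p) , inj₁ (proj₂ (∈initials⇒Del w p))
  ... | no ¬p = v ∷ w , inj₂ ((λ (_ , d) → ¬p (Del⇒∈initials d)) , refl)

  -- The letters act in turn, the last one first, on the empty word. `red-Step` checks the relations
  -- behind an arbitrary prefix, so the result depends, up to `~`, only on the group element.
  red : W → W
  red []      = []
  red (v ∷ w) = proj₁ (act v (red w))

  red-Reduced : ∀ w → Reduced (red w)
  red-Reduced []      = []
  red-Reduced (v ∷ w) = Act-Reduced (red-Reduced w) (proj₂ (act v (red w)))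

  red-++ : ∀ p {x y} → red x ~ red y → red (p ++ x) ~ red (p ++ y)
  red-++ []      r = r
  red-++ (v ∷ p) r = Act-resp-~ (red-++ p r) (proj₂ (act v _)) (proj₂ (act v _))

  red-Step : ∀ {x y} → Step Γ x y → red x ~ red y
  red-Step (cancel p q v)      = red-++ p
    (Act-involutive (red-Reduced q) (proj₂ (act v _)) (proj₂ (act v _)))
  red-Step (commute p q u v a) = red-++ p (~-sym
    (Act-comm {r = red q} a (proj₂ (act u _)) (proj₂ (act v _)) (proj₂ (act v _)) (proj₂ (act u _))))

  red-≈ : ∀ {x y} → _≈_ Γ x y → red x ~ red y
  red-≈ ε           = ~-refl
  red-≈ (fwd s ◅ p) = ~-trans (red-Step s) (red-≈ p)
  red-≈ (bwd s ◅ p) = ~-trans (~-sym (red-Step s)) (red-≈ p)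

  Del-length : ∀ {v w a} → Del v w a → length w ≡ suc (length a)
  Del-length here        = refl
  Del-length (there _ d) = cong suc (Del-length d)

  Act-length : ∀ {v w w′} → Act v w w′ → length w′ ≤ suc (length w)
  Act-length (inj₁ d) rewrite Del-length d = ℕₚ.m≤n⇒m≤1+n (ℕₚ.n≤1+n _)
  Act-length (inj₂ (_ , refl)) = ℕₚ.≤-refl

  red-length : ∀ w → length (red w) ≤ length w
  red-length []      = z≤n
  red-length (v ∷ w) = ℕₚ.≤-trans (Act-length (proj₂ (act v (red w)))) (s≤s (red-length w))

  Reduced⇒red≡ : ∀ {w} → Reduced w → red w ≡ w
  Reduced⇒red≡ [] = refl
  Reduced⇒red≡ {v ∷ w} (v∉ ∷ r) with act v (red w)
  ... | _ , inj₁ d rewrite Reduced⇒red≡ r = ⊥-elim (v∉ (Del⇒∈initials d))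
  ... | _ , inj₂ (_ , refl) = cong (v ∷_) (Reduced⇒red≡ r)

  -- A reduced word is its own normal form, equal words have normal forms of the same length, and
  -- `red` never lengthens a word.
  Reduced⇒Geodesic : ∀ {w} → Reduced w → Geodesic Γ w
  Reduced⇒Geodesic {w} r w′ p = subst (_≤ length w′)
    (trans (sym (~-length (red-≈ p))) (cong length (Reduced⇒red≡ r))) (red-length w′)

  ≈-cons : ∀ v {x y} → _≈_ Γ x y → _≈_ Γ (v ∷ x) (v ∷ y)
  ≈-cons v = gmap (v ∷_) (Sym.gmap (v ∷_) step)
    where
    step : ∀ {x y} → Step Γ x y → Step Γ (v ∷ x) (v ∷ y)
    step (cancel p q u)      = cancel (v ∷ p) q u
    step (commute p q u w a) = commute (v ∷ p) q u w a

  ~⇒≈ : ∀ {x y} → x ~ y → _≈_ Γ x y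
  ~⇒≈ ~-refl        = ε
  ~⇒≈ (~-trans p q) = ~⇒≈ p ◅◅ ~⇒≈ q
  ~⇒≈ (~-cons p)    = ≈-cons _ (~⇒≈ p)
  ~⇒≈ (~-swap a)    = fwd (commute [] _ _ _ a) ◅ ε

  Geodesic⇒Reduced : ∀ w → Geodesic Γ w → Reduced w
  Geodesic⇒Reduced []      g = []
  Geodesic⇒Reduced (v ∷ w) g =
    v∉ ∷ Geodesic⇒Reduced w (λ w′ p → ℕₚ.≤-pred (g (v ∷ w′) (≈-cons v p)))
    where
    v∉ : v ∉ initials w
    v∉ i with ∈initials⇒Del w i
    -- `v ∷ w` equals `v ∷ v ∷ w′` and hence `w′`, which is two letters shorter.
    ... | w′ , d = ℕₚ.<-irrefl refl (ℕₚ.≤-trans (ℕₚ.n≤1+n _)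
      (subst (λ k → suc k ≤ length w′) (Del-length d)
        (g w′ (≈-cons v (~⇒≈ (Del⇒~ d)) ◅◅ fwd (cancel [] w′ v) ◅ ε))))

  -- Only the first letter is tested, because `reducedWords` applies this to words with an already
  -- reduced tail. The empty word never arises there, so its value is arbitrary.
  Extends : W → Set
  Extends []      = ⊥
  Extends (v ∷ w) = v ∉ initials w

  extends? : ∀ w → Dec (Extends w)
  extends? []      = no λ ()
  extends? (v ∷ w) = ¬? (v ∈? initials w)

  reducedWords : ℕ → List W
  reducedWords 0       = [] ∷ []
  reducedWords (suc m) = filter extends? (cartesianProductWith _∷_ (allFin n) (reducedWords m))

  reducedWords-unique : ∀ m → Unique (reducedWords m)
  reducedWords-unique 0       = [] ∷ []
  reducedWords-unique (suc m) = Unique.filter⁺ extends?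
    (Unique.cartesianProductWith⁺ _∷_ List.∷-injective (Unique.allFin⁺ n) (reducedWords-unique m))

  ∈reducedWords⁻ : ∀ m {w} → w ∈ reducedWords m → length w ≡ m × Reduced w
  ∈reducedWords⁻ 0       (here refl) = refl , []
  ∈reducedWords⁻ (suc m) p with ∈-filter⁻ extends? p
  ... | q , e with ∈-cartesianProductWith⁻ _∷_ (allFin n) (reducedWords m) q
  ... | v , w , _ , w∈ , refl with ∈reducedWords⁻ m w∈
  ... | l , r = cong suc l , e ∷ r

  ∈reducedWords⁺ : ∀ {w} → Reduced w → w ∈ reducedWords (length w)
  ∈reducedWords⁺ []       = here refl
  ∈reducedWords⁺ (v∉ ∷ r) = ∈-filter⁺ extends?
    (∈-cartesianProductWith⁺ _∷_ (∈-allFin _) (∈reducedWords⁺ r)) v∉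

  reducedWords⇔ : ∀ m w → (w ∈ reducedWords m) ⇔ (length w ≡ m × Geodesic Γ w)
  reducedWords⇔ m w = mk⇔
    (λ p → proj₁ (∈reducedWords⁻ m p) , Reduced⇒Geodesic (proj₂ (∈reducedWords⁻ m p)))
    (λ { (refl , g) → ∈reducedWords⁺ (Geodesic⇒Reduced w g) })

-- Counting the neighbours in a clique

Bool-ext : ∀ {a b} → (a ≡ true → b ≡ true) → (b ≡ true → a ≡ true) → a ≡ b
Bool-ext {true}          p q = sym (p refl)
Bool-ext {false} {true}  p q = q refl
Bool-ext {false} {false} p q = refl

∧-true⁻ : ∀ {a b} → a ∧ b ≡ true → a ≡ true × b ≡ true
∧-true⁻ {true} p = refl , p

all⁺ : ∀ (p : A → Bool) xs → (∀ x → x ∈ xs → p x ≡ true) → all p xs ≡ true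
all⁺ p []       h = refl
all⁺ p (x ∷ xs) h rewrite h x (here refl) = all⁺ p xs λ y → h y ∘ there

all⁻ : ∀ (p : A → Bool) xs → all p xs ≡ true → ∀ {x} → x ∈ xs → p x ≡ true
all⁻ p (x ∷ xs) h (here refl) = proj₁ (∧-true⁻ h)
all⁻ p (x ∷ xs) h (there x∈)  = all⁻ p xs (proj₂ (∧-true⁻ {p x} h)) x∈

does-true⁻ : ∀ {P : Set} (P? : Dec P) → does P? ≡ true → P
does-true⁻ (yes p) _ = p

∣tabulate∣ : ∀ n (p : A → Bool) (g : Fin n → A) →
             + ∣ Vec.tabulate (p ∘ g) ∣ ≡ ∑ (tabulate g) (⟦_⟧ ∘ p)
∣tabulate∣ zero    p g = sym (∑-[] _)
∣tabulate∣ (suc n) p g = trans (lemma (p (g Fin.zero)))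
  (sym (∑-∷ (g Fin.zero) (tabulate (g ∘ Fin.suc)) (⟦_⟧ ∘ p)))
  where
  lemma : ∀ b → + ∣ b Vec.∷ Vec.tabulate (p ∘ g ∘ Fin.suc) ∣ ≡
                ⟦ b ⟧ + ∑ (tabulate (g ∘ Fin.suc)) (⟦_⟧ ∘ p)
  lemma true  = cong (λ x → + 1 + x) (∣tabulate∣ n p (g ∘ Fin.suc))
  lemma false = trans (∣tabulate∣ n p (g ∘ Fin.suc)) (sym (ℤₚ.+-identityˡ _))

-- Inclusion-exclusion: if `ℓ` counts the common neighbours of a clique of given size, this is the
-- number of common neighbours of an r-clique that are adjacent to none of m further vertices
-- extending it to a clique. For m = 1 the further vertex itself is among them, being not adjacent
-- to itself.
difference : (ℕ → ℤ) → ℕ → ℕ → ℤ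
difference ℓ zero    r = ℓ r
difference ℓ (suc m) r = difference ℓ m r - difference ℓ m (suc r)

difference-binomial : ∀ ℓ m r →
  difference ℓ m r ≡ binomialSum m (λ i → (- + 1) ^ i * ℓ (r ℕ.+ i))
difference-binomial ℓ zero    r = sym (begin
  binomialSum 0 h       ≡⟨ ∑-∷ 0 [] _ ⟩
  + 1 * h 0 + ∑ [] _    ≡⟨ +-congˡ (+ 1 * h 0) (∑-[] _) ⟩
  + 1 * h 0 + + 0       ≡⟨ lemma (ℓ (r ℕ.+ 0)) ⟩
  ℓ (r ℕ.+ 0)           ≡⟨ cong ℓ (ℕₚ.+-identityʳ r) ⟩
  ℓ r                   ∎)
  where
  h = λ i → (- + 1) ^ i * ℓ (r ℕ.+ i)
  lemma : ∀ x → + 1 * (+ 1 * x) + + 0 ≡ x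
  lemma = solve-∀
difference-binomial ℓ (suc m) r = begin
  difference ℓ m r - difference ℓ m (suc r)
    ≡⟨ cong₂ _-_ (difference-binomial ℓ m r) (difference-binomial ℓ m (suc r)) ⟩
  binomialSum m h - binomialSum m (λ i → (- + 1) ^ i * ℓ (suc r ℕ.+ i))
    ≡⟨ +-congˡ (binomialSum m h) (∑-neg (upTo (suc m)) _) ⟨
  binomialSum m h + ∑ (upTo (suc m)) (λ i → - (+ (m C i) * ((- + 1) ^ i * ℓ (suc r ℕ.+ i))))
    ≡⟨ +-congˡ (binomialSum m h) (∑-cong (upTo (suc m)) λ i →
         trans (lemma (+ (m C i)) ((- + 1) ^ i) _)
               (cong (λ j → + (m C i) * ((- + 1) ^ suc i * ℓ j)) (sym (ℕₚ.+-suc r i)))) ⟩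
  binomialSum m h + binomialSum m (h ∘ suc)
    ≡⟨ binomialSum-suc m h ⟨
  binomialSum (suc m) h ∎
  where
  h = λ i → (- + 1) ^ i * ℓ (r ℕ.+ i)
  lemma : ∀ c s x → - (c * (s * x)) ≡ c * ((- + 1) * s * x)
  lemma = solve-∀

-- For disjoint cliques σ and ρ of sizes k and r whose union is a clique, meetSum ℓ k r f is the
-- sum of f (number of neighbours of v in σ) over the common neighbours v of ρ. The recursion
-- moves a vertex s of σ to ρ, adding the correction f (suc j) - f j for the v adjacent to s.
meetSum : (ℕ → ℤ) → ℕ → ℕ → (ℕ → ℤ) → ℤ
meetSum ℓ zero    r f = f 0 * ℓ r
meetSum ℓ (suc k) r f = meetSum ℓ k r f + meetSum ℓ k (suc r) (λ j → f (suc j) - f j)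

-- Sorts the vertices by their set of neighbours in σ: each of the `k C j` sets of size j occurs
-- `difference ℓ (k ∸ j) (r + j)` times. In the induction, summation by parts moves the increments
-- of `f` onto `difference`, and Pascal's rule recombines the two halves.
meetSum-binomial : ∀ ℓ k r f →
  meetSum ℓ k r f ≡ binomialSum k (λ j → f j * difference ℓ (k ∸ j) (r ℕ.+ j))
meetSum-binomial ℓ zero r f = sym (begin
  binomialSum 0 _                              ≡⟨ ∑-∷ 0 [] _ ⟩
  + 1 * (f 0 * ℓ (r ℕ.+ 0)) + ∑ [] _           ≡⟨ +-congˡ (+ 1 * (f 0 * ℓ (r ℕ.+ 0))) (∑-[] _) ⟩
  + 1 * (f 0 * ℓ (r ℕ.+ 0)) + + 0              ≡⟨ lemma _ ⟩
  f 0 * ℓ (r ℕ.+ 0)                            ≡⟨ cong (λ i → f 0 * ℓ i) (ℕₚ.+-identityʳ r) ⟩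
  f 0 * ℓ r                                    ∎)
  where
  lemma : ∀ x → + 1 * x + + 0 ≡ x
  lemma = solve-∀
meetSum-binomial ℓ (suc k) r f = begin
  meetSum ℓ k r f + meetSum ℓ k (suc r) (λ j → f (suc j) - f j)
    ≡⟨ cong₂ _+_ (meetSum-binomial ℓ k r f) (meetSum-binomial ℓ k (suc r) _) ⟩
  binomialSum k (λ j → f j * D (k ∸ j) (r ℕ.+ j)) +
  binomialSum k (λ j → (f (suc j) - f j) * D (k ∸ j) (suc r ℕ.+ j))
    ≡⟨ ∑-+ (upTo (suc k)) _ _ ⟨
  ∑ (upTo (suc k)) (λ j → + (k C j) * (f j * D (k ∸ j) (r ℕ.+ j)) +
                          + (k C j) * ((f (suc j) - f j) * D (k ∸ j) (suc r ℕ.+ j)))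
    ≡⟨ ∑-upTo-cong (suc k) (λ j j<1+k → step j (ℕₚ.≤-pred j<1+k)) ⟩
  ∑ (upTo (suc k)) (λ j → + (k C j) * h j + + (k C j) * h (suc j))
    ≡⟨ ∑-+ (upTo (suc k)) _ _ ⟩
  binomialSum k h + binomialSum k (h ∘ suc)
    ≡⟨ binomialSum-suc k h ⟨
  binomialSum (suc k) h ∎
  where
  D = difference ℓ
  h = λ j → f j * D (suc k ∸ j) (r ℕ.+ j)
  rearrange : ∀ c x y a b → c * (x * a) + c * ((y - x) * b) ≡ c * (x * (a - b)) + c * (y * b)
  rearrange = solve-∀
  step : ∀ j → j ≤ k → + (k C j) * (f j * D (k ∸ j) (r ℕ.+ j)) +
                       + (k C j) * ((f (suc j) - f j) * D (k ∸ j) (suc r ℕ.+ j)) ≡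
                       + (k C j) * h j + + (k C j) * h (suc j)
  step j j≤k rewrite ℕₚ.+-∸-assoc 1 j≤k | ℕₚ.+-suc r j =
    rearrange (+ (k C j)) (f j) (f (suc j)) (D (k ∸ j) (r ℕ.+ j)) (D (k ∸ j) (suc (r ℕ.+ j)))

-- Prepending v to a word with initial letters σ, where σ has k elements, leaves one initial letter
-- more than v has neighbours in σ, hence `f ∘ suc`. With r = 0 `meetSum` runs over all vertices;
-- the k members of σ have k - 1 neighbours in σ each, so their share is k times `f k`.
transfer : (ℕ → ℤ) → (ℕ → ℤ) → ℕ → ℤ
transfer ℓ f k = meetSum ℓ k 0 (f ∘ suc) - + k * f k

-- When ℓ k is the size of the link of a k-clique, extensions ℓ m k is the number of ways
-- to prepend m letters to a reduced word with k initial letters keeping it reduced.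
extensions : (ℕ → ℤ) → ℕ → ℕ → ℤ
extensions ℓ zero    = λ _ → + 1
extensions ℓ (suc m) = transfer ℓ (extensions ℓ m)

-- Links of cliques and the reduction of the word count to link sizes

module Cliques (Γ : SimpleGraph) where
  open SimpleGraph Γ using (n; adj; irr) renaming (sym to adj-sym)
  open Words Γ
  open DecMembership {A = Fin n} _≟_ using (_∈?_)

  Clique : List (Fin n) → Set
  Clique = AllPairs Adj

  Clique⇒Unique : ∀ {σ} → Clique σ → Unique σ
  Clique⇒Unique = AllPairs.map λ { p refl → Adj-irr p }

  Clique⇒Adj : ∀ {σ u v} → Clique σ → u ∈ σ → v ∈ σ → u ≡ v ⊎ Adj u v
  Clique⇒Adj (p ∷ c) (here refl) (here refl) = inj₁ refl
  Clique⇒Adj (p ∷ c) (here refl) (there v∈)  = inj₂ (All.lookup p v∈)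
  Clique⇒Adj (p ∷ c) (there u∈)  (here refl) = inj₂ (Adj-sym (All.lookup p u∈))
  Clique⇒Adj (p ∷ c) (there u∈)  (there v∈)  = Clique⇒Adj c u∈ v∈

  isClique⁺ : ∀ σ → (∀ u v → lookup σ u ≡ true → lookup σ v ≡ true → u ≡ v ⊎ Adj u v) → IsClique Γ σ
  isClique⁺ σ h = all⁺ _ (allFin n) λ u _ → all⁺ _ (allFin n) λ v _ → pair u v
    where
    pair : ∀ u v → not (lookup σ u ∧ lookup σ v) ∨ does (u ≟ v) ∨ adj u v ≡ true
    pair u v with lookup σ u in eu | lookup σ v in ev
    ... | false | _     = refl
    ... | true  | false = refl
    ... | true  | true  with h u v eu ev
    ... | inj₁ u≡v rewrite dec-true (u ≟ v) u≡v = refl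
    ... | inj₂ a   rewrite a = Boolₚ.∨-zeroʳ _

  isClique⁻ : ∀ σ → IsClique Γ σ → ∀ u v → lookup σ u ≡ true → lookup σ v ≡ true → u ≡ v ⊎ Adj u v
  isClique⁻ σ h u v eu ev with all⁻ _ (allFin n) (all⁻ _ (allFin n) h (∈-allFin u)) (∈-allFin v)
  ... | p rewrite eu | ev with u ≟ v
  ... | yes u≡v = inj₁ u≡v
  ... | no _    = inj₂ p

  lookup-∪⁻ : ∀ (σ : Subset n) u v → lookup (σ ∪ ⁅ v ⁆) u ≡ true → lookup σ u ≡ true ⊎ u ≡ v
  lookup-∪⁻ σ u v p with Subset.x∈p∪q⁻ σ ⁅ v ⁆ (lookup⇒[]= u (σ ∪ ⁅ v ⁆) p)
  ... | inj₁ u∈ = inj₁ ([]=⇒lookup u∈)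
  ... | inj₂ u∈ = inj₂ (Subset.x∈⁅y⁆⇒x≡y v u∈)

  lookup-∪⁺ˡ : ∀ (σ : Subset n) u v → lookup σ u ≡ true → lookup (σ ∪ ⁅ v ⁆) u ≡ true
  lookup-∪⁺ˡ σ u v p = []=⇒lookup (Subset.x∈p∪q⁺ {p = σ} {q = ⁅ v ⁆} (inj₁ (lookup⇒[]= u σ p)))

  lookup-∪⁺ʳ : ∀ (σ : Subset n) v → lookup (σ ∪ ⁅ v ⁆) v ≡ true
  lookup-∪⁺ʳ σ v = []=⇒lookup (Subset.x∈p∪q⁺ {p = σ} {q = ⁅ v ⁆} (inj₂ (Subset.x∈⁅x⁆ v)))

  subset : List (Fin n) → Subset n
  subset ρ = Vec.tabulate (λ v → does (v ∈? ρ))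

  lookup-subset⁻ : ∀ ρ u → lookup (subset ρ) u ≡ true → u ∈ ρ
  lookup-subset⁻ ρ u p = does-true⁻ (u ∈? ρ) (trans (sym (lookup∘tabulate _ u)) p)

  lookup-subset⁺ : ∀ ρ {u} → u ∈ ρ → lookup (subset ρ) u ≡ true
  lookup-subset⁺ ρ {u} p = trans (lookup∘tabulate _ u) (dec-true (u ∈? ρ) p)

  subset-isClique : ∀ {ρ} → Clique ρ → IsClique Γ (subset ρ)
  subset-isClique {ρ} c = isClique⁺ (subset ρ) λ u v p q →
    Clique⇒Adj c (lookup-subset⁻ ρ u p) (lookup-subset⁻ ρ v q)

  ∑-delta : ∀ {xs : List (Fin n)} → Unique xs → ∀ {u} → u ∈ xs → (g : Fin n → ℤ) →
            ∑ xs (λ v → ⟦ does (v ≟ u) ⟧ * g v) ≡ g u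
  ∑-delta {x ∷ xs} (x∉ ∷ _) (here refl) g = begin
    ∑ (x ∷ xs) (λ v → ⟦ does (v ≟ x) ⟧ * g v)
      ≡⟨ ∑-∷ x xs _ ⟩
    ⟦ does (x ≟ x) ⟧ * g x + ∑ xs (λ v → ⟦ does (v ≟ x) ⟧ * g v)
      ≡⟨ cong₂ _+_ (cong (λ b → ⟦ b ⟧ * g x) (dec-true (x ≟ x) refl))
           (trans (∑-cong-∈ xs λ v v∈ → cong (λ b → ⟦ b ⟧ * g v)
                     (dec-false (v ≟ x) (All.lookup x∉ v∈ ∘ sym)))
                  (∑-zero xs)) ⟩
    + 1 * g x + + 0
      ≡⟨ trans (ℤₚ.+-identityʳ _) (ℤₚ.*-identityˡ (g x)) ⟩
    g x ∎
  ∑-delta {x ∷ xs} (x∉ ∷ uniq) {u} (there u∈) g = begin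
    ∑ (x ∷ xs) (λ v → ⟦ does (v ≟ u) ⟧ * g v)
      ≡⟨ ∑-∷ x xs _ ⟩
    ⟦ does (x ≟ u) ⟧ * g x + ∑ xs (λ v → ⟦ does (v ≟ u) ⟧ * g v)
      ≡⟨ cong₂ _+_ (cong (λ b → ⟦ b ⟧ * g x) (dec-false (x ≟ u) (All.lookup x∉ u∈))) (∑-delta uniq u∈ g) ⟩
    + 0 * g x + g u
      ≡⟨ ℤₚ.+-identityˡ (g u) ⟩
    g u ∎

  ∑-members : ∀ {σ} → Unique σ → (g : Fin n → ℤ) →
              ∑ (allFin n) (λ v → ⟦ does (v ∈? σ) ⟧ * g v) ≡ ∑ σ g
  ∑-members [] g = trans (∑-zero (allFin n)) (sym (∑-[] g))
  ∑-members {s ∷ σ} (s∉ ∷ uniq) g = begin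
    ∑ (allFin n) (λ v → ⟦ does (v ∈? (s ∷ σ)) ⟧ * g v)
      ≡⟨ ∑-cong (allFin n) split ⟩
    ∑ (allFin n) (λ v → ⟦ does (v ≟ s) ⟧ * g v + ⟦ does (v ∈? σ) ⟧ * g v)
      ≡⟨ ∑-+ (allFin n) _ _ ⟩
    ∑ (allFin n) (λ v → ⟦ does (v ≟ s) ⟧ * g v) + ∑ (allFin n) (λ v → ⟦ does (v ∈? σ) ⟧ * g v)
      ≡⟨ cong₂ _+_ (∑-delta (Unique.allFin⁺ n) (∈-allFin s) g) (∑-members uniq g) ⟩
    g s + ∑ σ g
      ≡⟨ ∑-∷ s σ g ⟨
    ∑ (s ∷ σ) g ∎
    where
    split : ∀ v → ⟦ does (v ∈? (s ∷ σ)) ⟧ * g v ≡ ⟦ does (v ≟ s) ⟧ * g v + ⟦ does (v ∈? σ) ⟧ * g v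
    split v with v ≟ s
    ... | yes refl = trans (sym (ℤₚ.+-identityʳ _)) (+-congˡ (+ 1 * g v)
      (cong (λ b → ⟦ b ⟧ * g v) (sym (dec-false (v ∈? σ) λ v∈ → All.lookup s∉ v∈ refl))))
    ... | no _     = sym (ℤₚ.+-identityˡ _)

  ∣subset∣ : ∀ {ρ} → Unique ρ → ∣ subset ρ ∣ ≡ length ρ
  ∣subset∣ {ρ} uniq = ℤₚ.+-injective (begin
    + ∣ subset ρ ∣                                     ≡⟨ ∣tabulate∣ n (λ v → does (v ∈? ρ)) id ⟩
    ∑ (allFin n) (λ v → ⟦ does (v ∈? ρ) ⟧)              ≡⟨ ∑-cong (allFin n) (λ v → sym (ℤₚ.*-identityʳ _)) ⟩
    ∑ (allFin n) (λ v → ⟦ does (v ∈? ρ) ⟧ * + 1)        ≡⟨ ∑-members uniq (λ _ → + 1) ⟩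
    ∑ ρ (λ _ → + 1)                                    ≡⟨ ∑-const ρ (+ 1) ⟩
    + length ρ * + 1                                   ≡⟨ ℤₚ.*-identityʳ _ ⟩
    + length ρ                                         ∎)

  commonNeighbour : List (Fin n) → Fin n → Bool
  commonNeighbour ρ v = all (adj v) ρ

  -- No vertex is adjacent to itself, so a common neighbour of ρ automatically lies outside ρ, as
  -- membership in the link demands.
  Lk-subset : ∀ {ρ} → Clique ρ → ∀ v →
    not (lookup (subset ρ) v) ∧ isCliqueᵇ Γ (subset ρ ∪ ⁅ v ⁆) ≡ commonNeighbour ρ v
  Lk-subset {ρ} c v = Bool-ext to from
    where
    τ = subset ρ ∪ ⁅ v ⁆
    to : not (lookup (subset ρ) v) ∧ isCliqueᵇ Γ τ ≡ true → commonNeighbour ρ v ≡ true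
    to p = all⁺ (adj v) ρ λ u u∈ → adjacent u u∈
             (isClique⁻ τ (proj₂ (∧-true⁻ {not (lookup (subset ρ) v)} p)) v u (lookup-∪⁺ʳ (subset ρ) v)
               (lookup-∪⁺ˡ (subset ρ) u v (lookup-subset⁺ ρ u∈)))
      where
      adjacent : ∀ u → u ∈ ρ → v ≡ u ⊎ Adj v u → Adj v u
      adjacent u u∈ (inj₂ a) = a
      adjacent u u∈ (inj₁ refl) with trans (sym (proj₁ (∧-true⁻ p))) (cong not (lookup-subset⁺ ρ u∈))
      ... | ()
    from : commonNeighbour ρ v ≡ true → not (lookup (subset ρ) v) ∧ isCliqueᵇ Γ τ ≡ true
    from p = cong₂ _∧_ (cong not v∉) (isClique⁺ τ λ u w eu ew →
               pair (lookup-∪⁻ (subset ρ) u v eu) (lookup-∪⁻ (subset ρ) w v ew))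
      where
      neighbour : ∀ {u} → lookup (subset ρ) u ≡ true → Adj v u
      neighbour {u} e = all⁻ (adj v) ρ p (lookup-subset⁻ ρ u e)
      v∉ : lookup (subset ρ) v ≡ false
      v∉ with lookup (subset ρ) v in e
      ... | false = refl
      ... | true  = ⊥-elim (Adj-irr (neighbour e))
      pair : ∀ {u w} → lookup (subset ρ) u ≡ true ⊎ u ≡ v → lookup (subset ρ) w ≡ true ⊎ w ≡ v → u ≡ w ⊎ Adj u w
      pair {u} {w} (inj₁ eu) (inj₁ ew)     = Clique⇒Adj c (lookup-subset⁻ ρ u eu) (lookup-subset⁻ ρ w ew)
      pair         (inj₁ eu) (inj₂ refl)   = inj₂ (Adj-sym (neighbour eu))
      pair         (inj₂ refl) (inj₁ ew)   = inj₂ (neighbour ew)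
      pair         (inj₂ refl) (inj₂ refl) = inj₁ refl

  ∣Lk-subset∣ : ∀ {ρ} → Clique ρ → + ∣ Lk Γ (subset ρ) ∣ ≡ ∑ (allFin n) (⟦_⟧ ∘ commonNeighbour ρ)
  ∣Lk-subset∣ c = trans (∣tabulate∣ n _ id) (∑-cong (allFin n) λ v → cong ⟦_⟧ (Lk-subset c v))

  neighbours : List (Fin n) → Fin n → List (Fin n)
  neighbours σ v = filter (adj? v) σ

  Clique⇒∣neighbours∣ : ∀ {σ v} → Clique σ → v ∈ σ → suc (length (neighbours σ v)) ≡ length σ
  Clique⇒∣neighbours∣ {s ∷ σ} (p ∷ c) (here refl) = cong (suc ∘ length)
    (trans (List.filter-reject (adj? s) Adj-irr) (List.filter-all (adj? s) p))
  Clique⇒∣neighbours∣ {s ∷ σ} {v} (p ∷ c) (there v∈) = trans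
    (cong (suc ∘ length) (List.filter-accept (adj? v) {s} {σ} (Adj-sym (All.lookup p v∈))))
    (cong suc (Clique⇒∣neighbours∣ c v∈))

  module LinkSizes (d : ℕ) (maxClique : MaxCliqueSize Γ d) (ℓ : ℕ → ℕ) (ℓ0≡n : ℓ 0 ≡ n)
    (linkSize : ∀ k → 1 ≤ k → k ≤ d → ∀ σ → IsClique Γ σ → ∣ σ ∣ ≡ k → ∣ Lk Γ σ ∣ ≡ ℓ k) where

    open Numbers ℓ d using (ℓℤ)

    Clique-length : ∀ {ρ} → Clique ρ → length ρ ≤ d
    Clique-length {ρ} c = subst (_≤ d) (∣subset∣ (Clique⇒Unique c))
      (proj₂ maxClique (subset ρ) (subset-isClique c))

    ∑-commonNeighbour : ∀ {ρ} → Clique ρ → ∑ (allFin n) (⟦_⟧ ∘ commonNeighbour ρ) ≡ ℓℤ (length ρ)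
    -- Every vertex is a common neighbour of the empty clique; `linkSize` starts at k = 1, so this
    -- case rests on ℓ 0 being the number of vertices.
    ∑-commonNeighbour {[]} c = begin
      ∑ (allFin n) (λ _ → + 1)       ≡⟨ ∑-const (allFin n) (+ 1) ⟩
      + length (allFin n) * + 1      ≡⟨ ℤₚ.*-identityʳ _ ⟩
      + length (allFin n)            ≡⟨ cong +_ (List.length-tabulate id) ⟩
      + n                            ≡⟨ cong +_ ℓ0≡n ⟨
      ℓℤ 0                           ∎
    ∑-commonNeighbour {ρ@(_ ∷ _)} c = trans (sym (∣Lk-subset∣ c))
      (cong +_ (linkSize (length ρ) (s≤s z≤n) (Clique-length c) (subset ρ)
        (subset-isClique c) (∣subset∣ (Clique⇒Unique c))))

    -- A vertex in the link of a clique of size d would enlarge that clique beyond the maximum. For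
    -- d = 0 the value is the number of vertices, and a single vertex would already be a clique of
    -- size 1.
    ℓd≡0 : ℓ d ≡ 0
    ℓd≡0 = go d refl
      where
      n≡0 : 0 ≡ d → ∀ k → n ≡ k → n ≡ 0
      n≡0 0≡d zero    e = e
      n≡0 0≡d (suc k) e with ℕₚ.≤-trans (Clique-length {subst Fin (sym e) Fin.zero ∷ []} ([] ∷ [])) (ℕₚ.≤-reflexive (sym 0≡d))
      ... | ()
      σ = proj₁ (proj₁ maxClique)
      ∣σ∣≡d = proj₂ (proj₂ (proj₁ maxClique))
      empty : Empty (Lk Γ σ)
      empty (v , v∈) with ∧-true⁻ {not (lookup σ v)} (trans (sym (lookup∘tabulate _ v)) ([]=⇒lookup v∈))
      ... | v∉ , σv-clique = ℕₚ.<⇒≱ (Subset.p⊂q⇒∣p∣<∣q∣ {p = σ} {q = σ ∪ ⁅ v ⁆} σ⊂)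
                               (subst (∣ σ ∪ ⁅ v ⁆ ∣ ≤_) (sym ∣σ∣≡d) (proj₂ maxClique (σ ∪ ⁅ v ⁆) σv-clique))
        where
        σ⊂ : σ ⊂ σ ∪ ⁅ v ⁆
        σ⊂ = Subset.p⊆p∪q ⁅ v ⁆ , v , Subset.x∈p∪q⁺ {p = σ} {q = ⁅ v ⁆} (inj₂ (Subset.x∈⁅x⁆ v)) ,
             λ v∈σ → case trans (sym v∉) (cong not ([]=⇒lookup v∈σ)) of λ ()
      go : ∀ k → k ≡ d → ℓ k ≡ 0
      go zero    0≡d = trans ℓ0≡n (n≡0 0≡d n refl)
      go (suc k) e   = begin
        ℓ (suc k)        ≡⟨ linkSize (suc k) (s≤s z≤n) (ℕₚ.≤-reflexive e) σ (proj₁ (proj₂ (proj₁ maxClique))) (trans ∣σ∣≡d (sym e)) ⟨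
        ∣ Lk Γ σ ∣ ≡⟨ cong ∣_∣ (Subset.Empty-unique empty) ⟩
        ∣ ⊥ₛ {n} ∣ ≡⟨ Subset.∣⊥∣≡0 n ⟩
        0 ∎

    ∑-meet : ∀ {σ ρ} → Clique σ → Clique ρ → All (λ s → All (Adj s) ρ) σ → (f : ℕ → ℤ) →
      ∑ (allFin n) (λ v → ⟦ commonNeighbour ρ v ⟧ * f (length (neighbours σ v))) ≡
      meetSum ℓℤ (length σ) (length ρ) f
    ∑-meet {[]} {ρ} cσ cρ _ f = begin
      ∑ (allFin n) (λ v → ⟦ commonNeighbour ρ v ⟧ * f 0)  ≡⟨ ∑-*ʳ (allFin n) (f 0) _ ⟩
      ∑ (allFin n) (⟦_⟧ ∘ commonNeighbour ρ) * f 0        ≡⟨ cong (_* f 0) (∑-commonNeighbour cρ) ⟩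
      ℓℤ (length ρ) * f 0                                ≡⟨ ℤₚ.*-comm (ℓℤ (length ρ)) (f 0) ⟩
      f 0 * ℓℤ (length ρ)                                ∎
    ∑-meet {s ∷ σ} {ρ} (sσ ∷ cσ) cρ (sρ ∷ σρ) f = begin
      ∑ (allFin n) (λ v → ⟦ commonNeighbour ρ v ⟧ * f (length (neighbours (s ∷ σ) v)))
        ≡⟨ ∑-cong (allFin n) split ⟩
      ∑ (allFin n) (λ v → ⟦ commonNeighbour ρ v ⟧ * f (length (neighbours σ v)) +
                          ⟦ commonNeighbour (s ∷ ρ) v ⟧ * Δf (length (neighbours σ v)))
        ≡⟨ ∑-+ (allFin n) _ _ ⟩
      ∑ (allFin n) (λ v → ⟦ commonNeighbour ρ v ⟧ * f (length (neighbours σ v))) +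
      ∑ (allFin n) (λ v → ⟦ commonNeighbour (s ∷ ρ) v ⟧ * Δf (length (neighbours σ v)))
        ≡⟨ cong₂ _+_ (∑-meet cσ cρ σρ f)
             (∑-meet cσ (sρ ∷ cρ) (All.zipWith (λ (a , b) → Adj-sym a ∷ b) (sσ , σρ)) Δf) ⟩
      meetSum ℓℤ (length σ) (length ρ) f + meetSum ℓℤ (length σ) (suc (length ρ)) Δf ∎
      where
      Δf = λ j → f (suc j) - f j
      lemma : ∀ b x y → b * y ≡ b * x + b * (y - x)
      lemma = solve-∀
      split : ∀ v → ⟦ commonNeighbour ρ v ⟧ * f (length (neighbours (s ∷ σ) v)) ≡
                    ⟦ commonNeighbour ρ v ⟧ * f (length (neighbours σ v)) +
                    ⟦ commonNeighbour (s ∷ ρ) v ⟧ * Δf (length (neighbours σ v))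
      split v with adj v s
      ... | true  = lemma ⟦ commonNeighbour ρ v ⟧ (f (length (neighbours σ v))) _
      ... | false = sym (ℤₚ.+-identityʳ _)

    ∑-nonmembers : ∀ {σ} → Clique σ → (f : ℕ → ℤ) →
      ∑ (allFin n) (λ v → ⟦ not (does (v ∈? σ)) ⟧ * f (suc (length (neighbours σ v)))) ≡
      transfer ℓℤ f (length σ)
    ∑-nonmembers {σ} c f = begin
      ∑ (allFin n) (λ v → ⟦ not (does (v ∈? σ)) ⟧ * g v)
        ≡⟨ ∑-cong (allFin n) (λ v → complement (does (v ∈? σ)) (g v)) ⟩
      ∑ (allFin n) (λ v → + 1 * g v - ⟦ does (v ∈? σ) ⟧ * g v)
        ≡⟨ ∑-- (allFin n) _ _ ⟩
      ∑ (allFin n) (λ v → + 1 * g v) - ∑ (allFin n) (λ v → ⟦ does (v ∈? σ) ⟧ * g v)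
        ≡⟨ cong₂ _-_ (∑-meet c [] (All.universal (λ _ → []) σ) (f ∘ suc)) (begin
             ∑ (allFin n) (λ v → ⟦ does (v ∈? σ) ⟧ * g v) ≡⟨ ∑-members (Clique⇒Unique c) g ⟩
             ∑ σ g                                        ≡⟨ ∑-cong-∈ σ (λ v v∈ → cong f (Clique⇒∣neighbours∣ c v∈)) ⟩
             ∑ σ (λ _ → f (length σ))                     ≡⟨ ∑-const σ _ ⟩
             + length σ * f (length σ)                    ∎) ⟩
      transfer ℓℤ f (length σ) ∎
      where
      g = λ v → f (suc (length (neighbours σ v)))
      complement : ∀ b x → ⟦ not b ⟧ * x ≡ + 1 * x - ⟦ b ⟧ * x
      complement true  = lemma
        where
        lemma : ∀ x → + 0 * x ≡ + 1 * x - + 1 * x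
        lemma = solve-∀
      complement false = lemma
        where
        lemma : ∀ x → + 1 * x ≡ + 1 * x - + 0 * x
        lemma = solve-∀

    -- Peels off the first letter: after exchanging the sums, the inner one runs, for a fixed tail
    -- `w`, over the letters outside the clique `initials w`.
    ∑-reducedWords-suc : ∀ m (f : ℕ → ℤ) →
      ∑ (reducedWords (suc m)) (f ∘ length ∘ initials) ≡
      ∑ (reducedWords m) (transfer ℓℤ f ∘ length ∘ initials)
    ∑-reducedWords-suc m f = begin
      ∑ (reducedWords (suc m)) (f ∘ length ∘ initials)
        ≡⟨ ∑-filter extends? (cartesianProductWith _∷_ (allFin n) (reducedWords m)) _ ⟩
      ∑ (cartesianProductWith _∷_ (allFin n) (reducedWords m)) (λ w → ⟦ does (extends? w) ⟧ * f (length (initials w)))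
        ≡⟨ ∑-cartesianProductWith _∷_ (allFin n) (reducedWords m) _ ⟩
      ∑ (allFin n) (λ v → ∑ (reducedWords m) (λ w →
        ⟦ not (does (v ∈? initials w)) ⟧ * f (suc (length (neighbours (initials w) v)))))
        ≡⟨ ∑-comm (allFin n) (reducedWords m) _ ⟩
      ∑ (reducedWords m) (λ w → ∑ (allFin n) (λ v →
        ⟦ not (does (v ∈? initials w)) ⟧ * f (suc (length (neighbours (initials w) v)))))
        ≡⟨ ∑-cong (reducedWords m) (λ w → ∑-nonmembers (initials-clique w) f) ⟩
      ∑ (reducedWords m) (transfer ℓℤ f ∘ length ∘ initials) ∎

    -- Each letter peeled off the words is traded for one more application of `transfer`, until only
    -- the empty word, with 0 initial letters, is left.
    ∑-extensions : ∀ m p → ∑ (reducedWords m) (extensions ℓℤ p ∘ length ∘ initials) ≡ extensions ℓℤ (m ℕ.+ p) 0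
    ∑-extensions zero    p = trans (∑-∷ [] [] _) (trans (+-congˡ (extensions ℓℤ p 0) (∑-[] {A = List (Fin n)} _)) (ℤₚ.+-identityʳ _))
    ∑-extensions (suc m) p = begin
      ∑ (reducedWords (suc m)) (extensions ℓℤ p ∘ length ∘ initials)  ≡⟨ ∑-reducedWords-suc m (extensions ℓℤ p) ⟩
      ∑ (reducedWords m) (extensions ℓℤ (suc p) ∘ length ∘ initials)  ≡⟨ ∑-extensions m (suc p) ⟩
      extensions ℓℤ (m ℕ.+ suc p) 0                                   ≡⟨ cong (λ i → extensions ℓℤ i 0) (ℕₚ.+-suc m p) ⟩
      extensions ℓℤ (suc m ℕ.+ p) 0                                   ∎

    length-reducedWords : ∀ m → + length (reducedWords m) ≡ extensions ℓℤ m 0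
    length-reducedWords m = begin
      + length (reducedWords m)                                 ≡⟨ ℤₚ.*-identityʳ _ ⟨
      + length (reducedWords m) * + 1                           ≡⟨ ∑-const (reducedWords m) (+ 1) ⟨
      ∑ (reducedWords m) (extensions ℓℤ 0 ∘ length ∘ initials)     ≡⟨ ∑-extensions m 0 ⟩
      extensions ℓℤ (m ℕ.+ 0) 0                                    ≡⟨ cong (λ i → extensions ℓℤ i 0) (ℕₚ.+-identityʳ m) ⟩
      extensions ℓℤ m 0                                            ∎

-- Power series and chains

≡ᵇ-refl : ∀ m → (m ≡ᵇ m) ≡ true
≡ᵇ-refl m = dec-true (m ℕₚ.≟ m) refl

≢⇒≡ᵇ-false : ∀ {m n} → m ≢ n → (m ≡ᵇ n) ≡ false
≢⇒≡ᵇ-false {m} {n} = dec-false (m ℕₚ.≟ n)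

<⇒<ᵇ-true : ∀ {m n} → m < n → (m <ᵇ n) ≡ true
<⇒<ᵇ-true {m} {n} = dec-true (m ℕₚ.<? n)

≮⇒<ᵇ-false : ∀ {m n} → ¬ m < n → (m <ᵇ n) ≡ false
≮⇒<ᵇ-false {m} {n} = dec-false (m ℕₚ.<? n)

∑-range-cong : ∀ {a b} {f g : ℕ → ℤ} → (∀ x → a ≤ x → x ≤ b → f x ≡ g x) →
               ∑ (range a b) f ≡ ∑ (range a b) g
∑-range-cong {a} {b} {f} {g} p = begin
  ∑ (range a b) f                              ≡⟨ ∑-range a b f ⟩
  ∑ (upTo (suc b ∸ a)) (λ i → f (a ℕ.+ i))     ≡⟨ ∑-upTo-cong (suc b ∸ a) (λ i i< → p (a ℕ.+ i) (ℕₚ.m≤m+n a i) (bound i i<)) ⟩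
  ∑ (upTo (suc b ∸ a)) (λ i → g (a ℕ.+ i))     ≡⟨ ∑-range a b g ⟨
  ∑ (range a b) g                              ∎
  where
  bound : ∀ i → i < suc b ∸ a → a ℕ.+ i ≤ b
  bound i i< = ℕₚ.≤-pred (subst (_≤ suc b) (cong suc (ℕₚ.+-comm i a))
    (ℕₚ.m≤o∸n⇒m+n≤o (suc i) (ℕₚ.<⇒≤ (ℕₚ.m∸n≢0⇒n<m (ℕₚ.m<n⇒n≢0 i<))) i<))

∑-upTo-truncate : ∀ {m n} (f : ℕ → ℤ) → m ≤ n → (∀ i → m ≤ i → f i ≡ + 0) → ∑ (upTo n) f ≡ ∑ (upTo m) f
∑-upTo-truncate {n = n} f z≤n p = trans (∑-cong (upTo n) λ i → p i z≤n) (trans (∑-zero (upTo n)) (sym (∑-[] f)))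
∑-upTo-truncate {suc m} {suc n} f (s≤s m≤n) p = begin
  ∑ (upTo (suc n)) f           ≡⟨ ∑-upTo-suc n f ⟩
  f 0 + ∑ (upTo n) (f ∘ suc)   ≡⟨ +-congˡ (f 0) (∑-upTo-truncate (f ∘ suc) m≤n λ i m≤i → p (suc i) (s≤s m≤i)) ⟩
  f 0 + ∑ (upTo m) (f ∘ suc)   ≡⟨ ∑-upTo-suc m f ⟨
  ∑ (upTo (suc m)) f           ∎

prodℤ-++ : ∀ xs ys → prodℤ (xs ++ ys) ≡ prodℤ xs * prodℤ ys
prodℤ-++ []       ys = sym (ℤₚ.*-identityˡ _)
prodℤ-++ (x ∷ xs) ys rewrite prodℤ-++ xs ys = sym (ℤₚ.*-assoc x _ _)

prodℤ-upTo-last : ∀ n (f : ℕ → ℤ) → prodℤ (map f (upTo (suc n))) ≡ prodℤ (map f (upTo n)) * f n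
prodℤ-upTo-last n f = begin
  prodℤ (map f (upTo (suc n)))            ≡⟨ cong (prodℤ ∘ map f) (List.upTo-∷ʳ n) ⟨
  prodℤ (map f (upTo n ++ n ∷ []))        ≡⟨ cong prodℤ (List.map-++ f (upTo n) (n ∷ [])) ⟩
  prodℤ (map f (upTo n) ++ f n ∷ [])      ≡⟨ prodℤ-++ (map f (upTo n)) (f n ∷ []) ⟩
  prodℤ (map f (upTo n)) * (f n * + 1)    ≡⟨ cong (prodℤ (map f (upTo n)) *_) (ℤₚ.*-identityʳ (f n)) ⟩
  prodℤ (map f (upTo n)) * f n            ∎

-- Multiplication by zᵏ; `δ` below is the series 1.
shift : ℕ → Series → Series
shift zero    f m       = f m
shift (suc k) f zero    = + 0
shift (suc k) f (suc m) = shift k f m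

δ : Series
δ zero    = + 1
δ (suc m) = + 0

shift-cong : ∀ k {f g : Series} m → (∀ m → f m ≡ g m) → shift k f m ≡ shift k g m
shift-cong zero    m       p = p m
shift-cong (suc k) zero    p = refl
shift-cong (suc k) (suc m) p = shift-cong k m p

shift-+ : ∀ k (f g : Series) m → shift k (λ m → f m + g m) m ≡ shift k f m + shift k g m
shift-+ zero    f g m       = refl
shift-+ (suc k) f g zero    = refl
shift-+ (suc k) f g (suc m) = shift-+ k f g m

shift-* : ∀ k c (f : Series) m → shift k (λ m → c * f m) m ≡ c * shift k f m
shift-* zero    c f m       = refl
shift-* (suc k) c f zero    = sym (ℤₚ.*-zeroʳ c)
shift-* (suc k) c f (suc m) = shift-* k c f m

shift-∑ : ∀ k (xs : List A) (f : A → Series) m →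
          shift k (λ m → ∑ xs (λ x → f x m)) m ≡ ∑ xs (λ x → shift k (f x) m)
shift-∑ zero    xs f m       = refl
shift-∑ (suc k) xs f zero    = sym (∑-zero xs)
shift-∑ (suc k) xs f (suc m) = shift-∑ k xs f m

shift-shift : ∀ j k (f : Series) m → shift j (shift k f) m ≡ shift (j ℕ.+ k) f m
shift-shift zero    k f m       = refl
shift-shift (suc j) k f zero    = refl
shift-shift (suc j) k f (suc m) = shift-shift j k f m

shift-comm : ∀ j k (f : Series) m → shift j (shift k f) m ≡ shift k (shift j f) m
shift-comm j k f m = begin
  shift j (shift k f) m   ≡⟨ shift-shift j k f m ⟩
  shift (j ℕ.+ k) f m     ≡⟨ cong (λ i → shift i f m) (ℕₚ.+-comm j k) ⟩
  shift (k ℕ.+ j) f m     ≡⟨ shift-shift k j f m ⟨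
  shift k (shift j f) m   ∎

shift-< : ∀ {k m} (f : Series) → m < k → shift k f m ≡ + 0
shift-< {suc k} {zero}  f _         = refl
shift-< {suc k} {suc m} f (s≤s m<k) = shift-< f m<k

shift-≤ : ∀ {k m} (f : Series) → k ≤ m → shift k f m ≡ f (m ∸ k)
shift-≤ f z≤n       = refl
shift-≤ f (s≤s k≤m) = shift-≤ f k≤m

shift-zero : ∀ k m → shift k (λ _ → + 0) m ≡ + 0
shift-zero zero    m       = refl
shift-zero (suc k) zero    = refl
shift-zero (suc k) (suc m) = shift-zero k m

shift-δ : ∀ k m → shift k δ m ≡ ⟦ k ≡ᵇ m ⟧
shift-δ zero    zero    = refl
shift-δ zero    (suc m) = refl
shift-δ (suc k) zero    = refl
shift-δ (suc k) (suc m) = shift-δ k m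

shift-δ-> : ∀ {k m} → k < m → shift k δ m ≡ + 0
shift-δ-> {k} {m} k<m = trans (shift-δ k m) (cong ⟦_⟧ (≢⇒≡ᵇ-false (ℕₚ.<⇒≢ k<m)))

-- The link between the recursive `shift` and the product of series: it lets the operators built
-- from shifts be recognised as multiplication by a polynomial.
shift-convolution : ∀ k (f : Series) m →
  shift k f m ≡ ∑ (upTo (suc m)) (λ i → shift k δ i * f (m ∸ i))
shift-convolution zero f m = sym (begin
  ∑ (upTo (suc m)) (λ i → δ i * f (m ∸ i))                        ≡⟨ ∑-upTo-suc m _ ⟩
  + 1 * f m + ∑ (upTo m) (λ i → + 0 * f (m ∸ suc i))              ≡⟨ cong₂ _+_ (ℤₚ.*-identityˡ (f m)) (∑-zero (upTo m)) ⟩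
  f m + + 0                                                      ≡⟨ ℤₚ.+-identityʳ (f m) ⟩
  f m                                                            ∎)
shift-convolution (suc k) f zero = sym (trans (∑-upTo-suc 0 _) (trans (ℤₚ.+-identityˡ _) (∑-[] _)))
shift-convolution (suc k) f (suc m) = begin
  shift k f m
    ≡⟨ shift-convolution k f m ⟩
  ∑ (upTo (suc m)) (λ i → shift k δ i * f (m ∸ i))
    ≡⟨ ℤₚ.+-identityˡ _ ⟨
  + 0 * f (suc m) + ∑ (upTo (suc m)) (λ i → shift k δ i * f (m ∸ i))
    ≡⟨ ∑-upTo-suc (suc m) (λ i → shift (suc k) δ i * f (suc m ∸ i)) ⟨
  ∑ (upTo (2 ℕ.+ m)) (λ i → shift (suc k) δ i * f (suc m ∸ i)) ∎

-- The linear system for the extension series and its solution by chains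

module Generating (ℓ : ℕ → ℕ) (d : ℕ) where
  open Numbers ℓ d

  P : ℕ → ℤ
  P k = prodℤ (map ℓℤ (upTo k))

  P-suc : ∀ k → P (suc k) ≡ P k * ℓℤ k
  P-suc k = prodℤ-upTo-last k ℓℤ

  P-+ : ∀ a i → P (a ℕ.+ i) ≡ P a * prodℤ (map ℓℤ (map (a ℕ.+_) (upTo i)))
  P-+ a zero    = trans (cong P (ℕₚ.+-identityʳ a)) (sym (ℤₚ.*-identityʳ (P a)))
  P-+ a (suc i) = begin
    P (a ℕ.+ suc i)                                                      ≡⟨ cong P (ℕₚ.+-suc a i) ⟩
    P (suc (a ℕ.+ i))                                                    ≡⟨ P-suc (a ℕ.+ i) ⟩
    P (a ℕ.+ i) * ℓℤ (a ℕ.+ i)                                            ≡⟨ cong (_* ℓℤ (a ℕ.+ i)) (P-+ a i) ⟩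
    P a * prodℤ (map ℓℤ (map (a ℕ.+_) (upTo i))) * ℓℤ (a ℕ.+ i)            ≡⟨ ℤₚ.*-assoc (P a) _ (ℓℤ (a ℕ.+ i)) ⟩
    P a * (prodℤ (map ℓℤ (map (a ℕ.+_) (upTo i))) * ℓℤ (a ℕ.+ i))          ≡⟨ cong (λ y → P a * (prodℤ y * ℓℤ (a ℕ.+ i))) (List.map-∘ (upTo i)) ⟨
    P a * (prodℤ (map (λ j → ℓℤ (a ℕ.+ j)) (upTo i)) * ℓℤ (a ℕ.+ i))       ≡⟨ cong (P a *_) (prodℤ-upTo-last i (λ j → ℓℤ (a ℕ.+ j))) ⟨
    P a * prodℤ (map (λ j → ℓℤ (a ℕ.+ j)) (upTo (suc i)))                 ≡⟨ cong (λ y → P a * prodℤ y) (List.map-∘ {g = ℓℤ} {f = a ℕ.+_} (upTo (suc i))) ⟩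
    P a * prodℤ (map ℓℤ (map (a ℕ.+_) (upTo (suc i))))                    ∎

  P-< : ∀ {j k} → j < k → P k ≡ P (suc j) * prodℤ (map ℓℤ (range (suc j) (k ∸ 1)))
  P-< {j} {suc k} (s≤s j≤k) = begin
    P (suc k)                                                             ≡⟨ cong (P ∘ suc) (ℕₚ.m+[n∸m]≡n j≤k) ⟨
    P (suc j ℕ.+ (k ∸ j))                                                 ≡⟨ P-+ (suc j) (k ∸ j) ⟩
    P (suc j) * prodℤ (map ℓℤ (range (suc j) k)) ∎

  w : ℕ → ℕ → ℤ
  w k j = + (k C j) * N k j

  -- The alternating sum in `N` is the inclusion-exclusion count of the vertices whose neighbours in
  -- a k-clique form a prescribed j-subset. Members of the clique have k - 1 neighbours in it, so
  -- none is counted here.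
  N-far : ∀ {j k} → suc j < k →
    N k j ≡ prodℤ (map ℓℤ (range (suc j) (k ∸ 1))) * difference ℓℤ (k ∸ j) j
  N-far {j} {k} 1+j<k rewrite <⇒<ᵇ-true 1+j<k = cong (prodℤ (map ℓℤ (range (suc j) (k ∸ 1))) *_) (begin
    sumℤ (map g (range j k))                                    ≡⟨ ∑-unfold (range j k) g ⟨
    ∑ (range j k) g                                             ≡⟨ ∑-range j k g ⟩
    ∑ (upTo (suc k ∸ j)) (λ i → g (j ℕ.+ i))                    ≡⟨ cong (λ b → ∑ (upTo b) (λ i → g (j ℕ.+ i))) (ℕₚ.+-∸-assoc 1 j≤k) ⟩
    ∑ (upTo (suc (k ∸ j))) (λ i → g (j ℕ.+ i))                  ≡⟨ ∑-cong (upTo (suc (k ∸ j))) term ⟩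
    binomialSum (k ∸ j) (λ i → (- + 1) ^ i * ℓℤ (j ℕ.+ i))      ≡⟨ difference-binomial ℓℤ (k ∸ j) j ⟨
    difference ℓℤ (k ∸ j) j                                     ∎)
    where
    j≤k : j ≤ k
    j≤k = ℕₚ.≤-trans (ℕₚ.n≤1+n j) (ℕₚ.<⇒≤ 1+j<k)
    g = λ i → + ((k ∸ j) C (i ∸ j)) * ((- + 1) ^ (i ∸ j)) * ℓℤ i
    term : ∀ i → g (j ℕ.+ i) ≡ + ((k ∸ j) C i) * ((- + 1) ^ i * ℓℤ (j ℕ.+ i))
    term i rewrite ℕₚ.m+n∸m≡n j i = ℤₚ.*-assoc (+ ((k ∸ j) C i)) _ _

  N-near : ∀ j → N (suc j) j ≡ ℓℤ j - ℓℤ (suc j) - + 1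
  N-near j rewrite ≮⇒<ᵇ-false (ℕₚ.n≮n j) | ≡ᵇ-refl j = refl

  -- The product of the ℓᵢ with j < i < k in `N k j` is the cofactor of `P (suc j)` in `P k`, so it
  -- absorbs the change of scaling from k to j + 1.
  far-term : ∀ {j k} y → suc j < k →
    P k * (+ (k C j) * (y * difference ℓℤ (k ∸ j) j)) ≡ w k j * (P (suc j) * y)
  far-term {j} {k} y 1+j<k rewrite N-far 1+j<k | P-< {j} {k} (ℕₚ.<⇒≤ 1+j<k) =
    lemma (P (suc j)) (prodℤ (map ℓℤ (range (suc j) (k ∸ 1)))) (+ (k C j)) y (difference ℓℤ (k ∸ j) j)
    where
    lemma : ∀ p q c y e → p * q * (c * (y * e)) ≡ c * (q * e) * (p * y)
    lemma = solve-∀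

  nC[n-1]≡n : ∀ j → suc j C j ≡ suc j
  nC[n-1]≡n j = begin
    suc j C j             ≡⟨ nCk≡nC[n∸k] (ℕₚ.n≤1+n j) ⟩
    suc j C (suc j ∸ j)   ≡⟨ cong (suc j C_) (ℕₚ.m+n∸n≡m 1 j) ⟩
    suc j C 1             ≡⟨ nC1≡n (suc j) ⟩
    suc j                 ∎

  -- Origin of the -1 in `N (suc j) j`: here the difference ℓ_j - ℓ_{j+1} also counts one member of
  -- the clique, and over the `suc j C j` = j + 1 subsets these members are exactly the ones that
  -- `transfer` subtracts.
  near-term : ∀ j y →
    P (suc j) * (+ (suc j C j) * (y * difference ℓℤ (suc j ∸ j) j)) - P (suc j) * (+ suc j * y) ≡
    w (suc j) j * (P (suc j) * y)
  near-term j y rewrite N-near j | nC[n-1]≡n j | ℕₚ.m+n∸n≡m 1 j =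
    lemma (P (suc j)) (+ suc j) y (ℓℤ j) (ℓℤ (suc j))
    where
    lemma : ∀ p c y a b → p * (c * (y * (a - b))) - p * (c * y) ≡ c * (a - b - + 1) * (p * y)
    lemma = solve-∀

  -- The letters adjacent to the whole clique raise its size to k + 1; their number ℓ_k is just the
  -- next factor of the scaling, so the superdiagonal coefficient becomes 1.
  top-term : ∀ k y → P k * (+ (k C k) * (y * difference ℓℤ (k ∸ k) k)) ≡ P (suc k) * y
  top-term k y rewrite nCn≡1 k | ℕₚ.n∸n≡0 k | P-suc k = lemma (P k) y (ℓℤ k)
    where
    lemma : ∀ p y l → p * (+ 1 * (y * l)) ≡ p * l * y
    lemma = solve-∀

  P*transfer : ∀ k f → P k * transfer ℓℤ f k ≡
    P (suc k) * f (suc k) + ∑ (upTo k) (λ j → w k j * (P (suc j) * f (suc j)))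
  P*transfer k f = begin
    P k * (meetSum ℓℤ k 0 (f ∘ suc) - + k * f k)
      ≡⟨ cong (λ s → P k * (s - + k * f k)) (meetSum-binomial ℓℤ k 0 (f ∘ suc)) ⟩
    P k * (binomialSum k (λ j → f (suc j) * difference ℓℤ (k ∸ j) j) - + k * f k)
      ≡⟨ distrib (P k) _ (+ k * f k) ⟩
    P k * binomialSum k (λ j → f (suc j) * difference ℓℤ (k ∸ j) j) - P k * (+ k * f k)
      ≡⟨ cong (_- P k * (+ k * f k)) (∑-*ˡ (upTo (suc k)) (P k) _) ⟨
    ∑ (upTo (suc k)) (summand k) - P k * (+ k * f k)
      ≡⟨ cong (_- P k * (+ k * f k)) (∑-upTo-last k _) ⟩
    ∑ (upTo k) (summand k) + summand k k - P k * (+ k * f k)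
      ≡⟨ cong (λ y → ∑ (upTo k) (summand k) + y - P k * (+ k * f k)) (top-term k (f (suc k))) ⟩
    ∑ (upTo k) (summand k) + P (suc k) * f (suc k) - P k * (+ k * f k)
      ≡⟨ rearrange (∑ (upTo k) (summand k)) _ _ ⟩
    P (suc k) * f (suc k) + (∑ (upTo k) (summand k) - P k * (+ k * f k))
      ≡⟨ +-congˡ (P (suc k) * f (suc k)) (lower k) ⟩
    P (suc k) * f (suc k) + ∑ (upTo k) (λ j → w k j * (P (suc j) * f (suc j))) ∎
    where
    distrib : ∀ p s t → p * (s - t) ≡ p * s - p * t
    distrib = solve-∀
    rearrange : ∀ a b c → a + b - c ≡ b + (a - c)
    rearrange = solve-∀
    summand : ℕ → ℕ → ℤ
    summand k j = P k * (+ (k C j) * (f (suc j) * difference ℓℤ (k ∸ j) j))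
    lower : ∀ k → ∑ (upTo k) (summand k) - P k * (+ k * f k) ≡
                  ∑ (upTo k) (λ j → w k j * (P (suc j) * f (suc j)))
    -- The subtracted share of the members belongs to j = k - 1, which exists only for k > 0; for k
    -- = 0 it is zero.
    lower zero    = trans (cong (_- P 0 * (+ 0 * f 0)) (∑-[] _)) (sym (∑-[] _))
    lower (suc k) = begin
      ∑ (upTo (suc k)) (summand (suc k)) - P (suc k) * (+ suc k * f (suc k))
        ≡⟨ cong (_- P (suc k) * (+ suc k * f (suc k))) (∑-upTo-last k _) ⟩
      ∑ (upTo k) (summand (suc k)) + summand (suc k) k - P (suc k) * (+ suc k * f (suc k))
        ≡⟨ ℤₚ.+-assoc (∑ (upTo k) (summand (suc k))) _ _ ⟩
      ∑ (upTo k) (summand (suc k)) + (summand (suc k) k - P (suc k) * (+ suc k * f (suc k)))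
        ≡⟨ cong₂ _+_ (∑-upTo-cong k λ j j<k → far-term (f (suc j)) (s≤s j<k)) (near-term k (f (suc k))) ⟩
      ∑ (upTo k) (λ j → w (suc k) j * (P (suc j) * f (suc j))) + w (suc k) k * (P (suc k) * f (suc k))
        ≡⟨ ∑-upTo-last k (λ j → w (suc k) j * (P (suc j) * f (suc j))) ⟨
      ∑ (upTo (suc k)) (λ j → w (suc k) j * (P (suc j) * f (suc j))) ∎

  -- With X k the series of extensions of a word with k initial letters and ℓ₀⋯ℓₖ₋₁ = P k, the
  -- series Y k is P k X k and U k is zᵏ P k X k: this scaling turns the transfer coefficients
  -- into the numbers N.
  Y : ℕ → Series
  Y k m = P k * extensions ℓℤ m k

  Y-rec : ∀ k m → Y k m ≡
    P k * δ m + shift 1 (Y (suc k)) m + ∑ (upTo k) (λ j → w k j * shift 1 (Y (suc j)) m)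
  Y-rec k zero    = sym (trans (cong₂ _+_ (ℤₚ.+-identityʳ (P k * + 1))
    (trans (∑-cong (upTo k) λ j → ℤₚ.*-zeroʳ (w k j)) (∑-zero (upTo k)))) (ℤₚ.+-identityʳ _))
  Y-rec k (suc m) = trans (P*transfer k (extensions ℓℤ m)) (cong (_+ ∑ (upTo k) (λ j → w k j * Y (suc j) m))
    (sym (trans (cong (_+ Y (suc k) m) (ℤₚ.*-zeroʳ (P k))) (ℤₚ.+-identityˡ (Y (suc k) m)))))

  U : ℕ → Series
  U k = shift k (Y k)

  -- The prepended letter costs one z, and zᵏ z = zᵏ⁻ʲ zʲ⁺¹: a factor zᵏ⁻ʲ remains before U (j+1),
  -- and none before U (k+1).
  U-rec : ∀ k m → U k m ≡
    P k * shift k δ m + U (suc k) m + ∑ (upTo k) (λ j → w k j * shift (k ∸ j) (U (suc j)) m)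
  U-rec k m = begin
    shift k (Y k) m
      ≡⟨ shift-cong k m (Y-rec k) ⟩
    shift k (λ m → P k * δ m + shift 1 (Y (suc k)) m + ∑ (upTo k) (λ j → w k j * shift 1 (Y (suc j)) m)) m
      ≡⟨ shift-+ k (λ m → P k * δ m + shift 1 (Y (suc k)) m) _ m ⟩
    shift k (λ m → P k * δ m + shift 1 (Y (suc k)) m) m +
    shift k (λ m → ∑ (upTo k) (λ j → w k j * shift 1 (Y (suc j)) m)) m
      ≡⟨ cong₂ _+_
           (trans (shift-+ k (λ m → P k * δ m) (shift 1 (Y (suc k))) m)
                  (cong₂ _+_ (shift-* k (P k) δ m)
                    (trans (shift-shift k 1 (Y (suc k)) m) (cong (λ i → shift i (Y (suc k)) m) (ℕₚ.+-comm k 1)))))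
           (trans (shift-∑ k (upTo k) (λ j m → w k j * shift 1 (Y (suc j)) m) m)
                  (∑-upTo-cong k λ j j<k → trans (shift-* k (w k j) (shift 1 (Y (suc j))) m) (cong (w k j *_) (reshift j j<k)))) ⟩
    P k * shift k δ m + U (suc k) m + ∑ (upTo k) (λ j → w k j * shift (k ∸ j) (U (suc j)) m) ∎
    where
    reshift : ∀ j → j < k → shift k (shift 1 (Y (suc j))) m ≡ shift (k ∸ j) (U (suc j)) m
    reshift j j<k = begin
      shift k (shift 1 (Y (suc j))) m          ≡⟨ shift-shift k 1 (Y (suc j)) m ⟩
      shift (k ℕ.+ 1) (Y (suc j)) m            ≡⟨ cong (λ i → shift i (Y (suc j)) m) eq ⟩
      shift (k ∸ j ℕ.+ suc j) (Y (suc j)) m    ≡⟨ shift-shift (k ∸ j) (suc j) (Y (suc j)) m ⟨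
      shift (k ∸ j) (U (suc j)) m              ∎
      where
      eq : k ℕ.+ 1 ≡ k ∸ j ℕ.+ suc j
      eq = begin
        k ℕ.+ 1               ≡⟨ ℕₚ.+-comm k 1 ⟩
        suc k                 ≡⟨ cong suc (ℕₚ.m∸n+n≡m (ℕₚ.<⇒≤ j<k)) ⟨
        suc (k ∸ j ℕ.+ j)     ≡⟨ ℕₚ.+-suc (k ∸ j) j ⟨
        k ∸ j ℕ.+ suc j       ∎

  U-top : ℓ d ≡ 0 → ∀ m → U (suc d) m ≡ + 0
  U-top ℓd≡0 m = trans (shift-cong (suc d) {Y (suc d)} {λ _ → + 0} m Y-top) (shift-zero (suc d) m)
    where
    Y-top : ∀ m → Y (suc d) m ≡ + 0
    Y-top m rewrite P-suc d | ℓd≡0 | ℤₚ.*-zeroʳ (P d) = refl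

  -- Multiplication by the weighted generating polynomial of the chains that start at j or later
  -- and have at most f links.
  chainOp : ℕ → ℕ → Series → Series
  chainOp f j X m = ∑ (chains f j) (λ c → weight c * shift (total c) X m)

  chainOp-cong : ∀ f j {X Z : Series} m → (∀ m → X m ≡ Z m) → chainOp f j X m ≡ chainOp f j Z m
  chainOp-cong f j m p = ∑-cong (chains f j) λ c → cong (weight c *_) (shift-cong (total c) m p)

  chainOp-+ : ∀ f j (X Z : Series) m → chainOp f j (λ m → X m + Z m) m ≡ chainOp f j X m + chainOp f j Z m
  chainOp-+ f j X Z m = trans
    (∑-cong (chains f j) λ c → trans (cong (weight c *_) (shift-+ (total c) X Z m)) (ℤₚ.*-distribˡ-+ (weight c) _ _))
    (∑-+ (chains f j) _ _)

  swap-factor : ∀ a b c → a * (b * c) ≡ b * (a * c)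
  swap-factor = solve-∀

  chainOp-* : ∀ f j a (X : Series) m → chainOp f j (λ m → a * X m) m ≡ a * chainOp f j X m
  chainOp-* f j a X m = trans
    (∑-cong (chains f j) λ c → trans (cong (weight c *_) (shift-* (total c) a X m)) (swap-factor (weight c) a _))
    (∑-*ˡ (chains f j) a _)

  chainOp-∑ : ∀ f j (xs : List A) (X : A → Series) m →
              chainOp f j (λ m → ∑ xs (λ i → X i m)) m ≡ ∑ xs (λ i → chainOp f j (X i) m)
  chainOp-∑ f j xs X m = trans
    (∑-cong (chains f j) λ c → trans (cong (weight c *_) (shift-∑ (total c) xs X m)) (sym (∑-*ˡ xs (weight c) _)))
    (∑-comm (chains f j) xs _)

  chainOp-shift : ∀ f j k (X : Series) m → chainOp f j (shift k X) m ≡ shift k (chainOp f j X) m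
  chainOp-shift f j k X m = begin
    ∑ (chains f j) (λ c → weight c * shift (total c) (shift k X) m)
      ≡⟨ ∑-cong (chains f j) (λ c → cong (weight c *_) (shift-comm (total c) k X m)) ⟩
    ∑ (chains f j) (λ c → weight c * shift k (shift (total c) X) m)
      ≡⟨ ∑-cong (chains f j) (λ c → shift-* k (weight c) (shift (total c) X) m) ⟨
    ∑ (chains f j) (λ c → shift k (λ m → weight c * shift (total c) X m) m)
      ≡⟨ shift-∑ k (chains f j) _ m ⟨
    shift k (chainOp f j X) m ∎

  chainOp-unfold : ∀ f j (X : Series) m → chainOp (suc f) j X m ≡
    X m + ∑ (range j d) (λ s → ∑ (range (suc s) d) (λ t → - w t s * chainOp f t (shift (t ∸ s) X) m))
  chainOp-unfold f j X m = begin
    chainOp (suc f) j X m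
      ≡⟨ ∑-∷ [] _ term ⟩
    + 1 * X m + ∑ _ term
      ≡⟨ cong₂ _+_ (ℤₚ.*-identityˡ (X m)) (begin
           ∑ _ term
             ≡⟨ ∑-concatMap _ (range j d) term ⟩
           ∑ (range j d) (λ s → ∑ _ term)
             ≡⟨ ∑-cong (range j d) (λ s → trans (∑-concatMap _ (range (suc s) d) term)
                  (∑-cong (range (suc s) d) λ t → link s t)) ⟩
           ∑ (range j d) (λ s → ∑ (range (suc s) d) (λ t → - w t s * chainOp f t (shift (t ∸ s) X) m)) ∎) ⟩
    X m + ∑ (range j d) (λ s → ∑ (range (suc s) d) (λ t → - w t s * chainOp f t (shift (t ∸ s) X) m)) ∎
    where
    term : List (ℕ × ℕ) → ℤ
    term c = weight c * shift (total c) X m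
    regroup : ∀ a b c y → (- + 1) * a * b * c * y ≡ - (a * b) * (c * y)
    regroup = solve-∀
    link : ∀ s t → ∑ (map ((s , t) ∷_) (chains f t)) term ≡ - w t s * chainOp f t (shift (t ∸ s) X) m
    link s t = begin
      ∑ (map ((s , t) ∷_) (chains f t)) term
        ≡⟨ ∑-map ((s , t) ∷_) (chains f t) term ⟩
      ∑ (chains f t) (λ c → term ((s , t) ∷ c))
        ≡⟨ ∑-cong (chains f t) (λ c → trans
             (regroup (+ (t C s)) (N t s) (weight c) (shift (t ∸ s ℕ.+ total c) X m))
             (cong (λ y → - w t s * (weight c * y))
               (trans (sym (shift-shift (t ∸ s) (total c) X m)) (shift-comm (t ∸ s) (total c) X m)))) ⟩
      ∑ (chains f t) (λ c → - w t s * (weight c * shift (total c) (shift (t ∸ s) X) m))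
        ≡⟨ ∑-*ˡ (chains f t) (- w t s) _ ⟩
      - w t s * chainOp f t (shift (t ∸ s) X) m ∎

  chainOp-0 : ∀ j (X : Series) m → chainOp 0 j X m ≡ X m
  chainOp-0 j X m = trans (∑-∷ [] [] _) (trans (cong₂ _+_ (ℤₚ.*-identityˡ (X m)) (∑-[] {A = List (ℕ × ℕ)} _)) (ℤₚ.+-identityʳ (X m)))

  -- Every link raises the starting point by at least one and ends at most at d, so no chain from j
  -- has more than d - j links.
  chainOp-fuel : ∀ f j → d ≤ f ℕ.+ j → ∀ (X : Series) m → chainOp (suc f) j X m ≡ chainOp f j X m
  chainOp-fuel zero j d≤j X m = begin
    chainOp 1 j X m
      ≡⟨ chainOp-unfold 0 j X m ⟩
    X m + ∑ (range j d) (λ s → ∑ (range (suc s) d) (λ t → - w t s * chainOp 0 t (shift (t ∸ s) X) m))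
      ≡⟨ +-congˡ (X m) (trans (∑-range-cong {g = λ _ → + 0} λ s j≤s _ → ∑-range-empty _ (s≤s (ℕₚ.≤-trans d≤j j≤s))) (∑-zero (range j d))) ⟩
    X m + + 0
      ≡⟨ ℤₚ.+-identityʳ (X m) ⟩
    X m
      ≡⟨ chainOp-0 j X m ⟨
    chainOp 0 j X m ∎
  chainOp-fuel (suc f) j d≤ X m = begin
    chainOp (2 ℕ.+ f) j X m
      ≡⟨ chainOp-unfold (suc f) j X m ⟩
    X m + ∑ (range j d) (λ s → ∑ (range (suc s) d) (λ t → - w t s * chainOp (suc f) t (shift (t ∸ s) X) m))
      ≡⟨ +-congˡ (X m) (∑-range-cong λ s j≤s _ → ∑-range-cong λ t s<t _ → cong (- w t s *_)
           (chainOp-fuel f t (bound j≤s s<t) (shift (t ∸ s) X) m)) ⟩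
    X m + ∑ (range j d) (λ s → ∑ (range (suc s) d) (λ t → - w t s * chainOp f t (shift (t ∸ s) X) m))
      ≡⟨ chainOp-unfold f j X m ⟨
    chainOp (suc f) j X m ∎
    where
    bound : ∀ {s t} → j ≤ s → s < t → d ≤ f ℕ.+ t
    bound {s} {t} j≤s s<t = ℕₚ.≤-trans d≤ (subst (_≤ f ℕ.+ t) (ℕₚ.+-suc f j) (ℕₚ.+-monoʳ-≤ f (ℕₚ.≤-trans (s≤s j≤s) s<t)))

  D : ℕ → Series → Series
  D = chainOp (suc d)

  D-rec : ∀ {j} → j ≤ d → ∀ (X : Series) m →
    D (suc j) X m ≡ D j X m + ∑ (range (suc j) d) (λ t → w t j * D t (shift (t ∸ j) X) m)
  D-rec {j} j≤d X m = sym (begin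
    D j X m + ∑ (range (suc j) d) (λ t → w t j * D t (shift (t ∸ j) X) m)
      ≡⟨ cong (_+ S) (begin
           D j X m                                        ≡⟨ chainOp-unfold d j X m ⟩
           X m + ∑ (range j d) inner                      ≡⟨ +-congˡ (X m) (∑-range-first inner j≤d) ⟩
           X m + (inner j + ∑ (range (suc j) d) inner)    ≡⟨ +-congˡ (X m) (cong (_+ ∑ (range (suc j) d) inner) (begin
             inner j
               ≡⟨ ∑-cong (range (suc j) d) (λ t → trans
                    -- Removing the first link leaves tails with fuel d, one less than in `D`; the
                    -- missing unit is restored without changing the value.
                    (cong (- w t j *_) (sym (chainOp-fuel d t (ℕₚ.m≤m+n d t) (shift (t ∸ j) X) m)))
                    (sym (ℤₚ.neg-distribˡ-* (w t j) _))) ⟩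
             ∑ (range (suc j) d) (λ t → - (w t j * D t (shift (t ∸ j) X) m))
               ≡⟨ ∑-neg (range (suc j) d) _ ⟩
             - S ∎)) ⟩
           X m + (- S + ∑ (range (suc j) d) inner)        ∎) ⟩
    X m + (- S + ∑ (range (suc j) d) inner) + S
      ≡⟨ cancelled (X m) S _ ⟩
    X m + ∑ (range (suc j) d) inner
      ≡⟨ chainOp-unfold d (suc j) X m ⟨
    D (suc j) X m ∎)
    where
    S = ∑ (range (suc j) d) (λ t → w t j * D t (shift (t ∸ j) X) m)
    inner = λ s → ∑ (range (suc s) d) (λ t → - w t s * chainOp d t (shift (t ∸ s) X) m)
    cancelled : ∀ a b c → a + (- b + c) + b ≡ a + c
    cancelled = solve-∀

  D-zero : ∀ j {X : Series} m → (∀ m → X m ≡ + 0) → D j X m ≡ + 0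
  D-zero j m p = trans (∑-cong (chains (suc d) j) λ c → trans
    (cong (weight c *_) (trans (shift-cong (total c) m p) (shift-zero (total c) m))) (ℤₚ.*-zeroʳ (weight c)))
    (∑-zero (chains (suc d) j))

  D-U : ∀ k m → D k (U k) m ≡
    P k * shift k (D k δ) m + D k (U (suc k)) m + ∑ (upTo k) (λ j → w k j * D k (shift (k ∸ j) (U (suc j))) m)
  D-U k m = begin
    D k (U k) m
      ≡⟨ chainOp-cong (suc d) k m (U-rec k) ⟩
    D k (λ m → P k * shift k δ m + U (suc k) m + ∑ (upTo k) (λ j → w k j * shift (k ∸ j) (U (suc j)) m)) m
      ≡⟨ chainOp-+ (suc d) k (λ m → P k * shift k δ m + U (suc k) m) _ m ⟩
    D k (λ m → P k * shift k δ m + U (suc k) m) m + D k (λ m → ∑ (upTo k) (λ j → w k j * shift (k ∸ j) (U (suc j)) m)) m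
      ≡⟨ cong₂ _+_
           (trans (chainOp-+ (suc d) k (λ m → P k * shift k δ m) (U (suc k)) m)
             (cong (_+ D k (U (suc k)) m) (trans (chainOp-* (suc d) k (P k) (shift k δ) m)
               (cong (P k *_) (chainOp-shift (suc d) k k δ m)))))
           (trans (chainOp-∑ (suc d) k (upTo k) (λ j m → w k j * shift (k ∸ j) (U (suc j)) m) m)
             (∑-cong (upTo k) λ j → chainOp-* (suc d) k (w k j) (shift (k ∸ j) (U (suc j))) m)) ⟩
    P k * shift k (D k δ) m + D k (U (suc k)) m + ∑ (upTo k) (λ j → w k j * D k (shift (k ∸ j) (U (suc j))) m) ∎

  -- Adding the sum of the D (k+1) U (k+1) completes the left side to the sum of all D k U k. Once
  -- the system is substituted, the same sum reappears on the right through `D-rec` and cancels.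
  D-U-telescope : ℓ d ≡ 0 → ∀ m → D 0 (U 0) m ≡ ∑ (upTo (suc d)) (λ k → P k * shift k (D k δ) m)
  D-U-telescope ℓd≡0 m = ∙-cancelʳ (∑ (upTo (suc d)) (λ k → D (suc k) (U (suc k)) m)) _ _ (begin
    D 0 (U 0) m + ∑ (upTo (suc d)) (λ k → D (suc k) (U (suc k)) m)
      ≡⟨ ∑-upTo-suc (suc d) (λ k → D k (U k) m) ⟨
    ∑ (upTo (2 ℕ.+ d)) (λ k → D k (U k) m)
      ≡⟨ ∑-upTo-last (suc d) (λ k → D k (U k) m) ⟩
    ∑ (upTo (suc d)) (λ k → D k (U k) m) + D (suc d) (U (suc d)) m
      ≡⟨ trans (+-congˡ (∑ (upTo (suc d)) (λ k → D k (U k) m)) (D-zero (suc d) m (U-top ℓd≡0))) (ℤₚ.+-identityʳ _) ⟩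
    ∑ (upTo (suc d)) (λ k → D k (U k) m)
      ≡⟨ ∑-cong (upTo (suc d)) (λ k → D-U k m) ⟩
    ∑ (upTo (suc d)) (λ k → R k + V k + ∑ (upTo k) (T k))
      ≡⟨ trans (∑-+ (upTo (suc d)) (λ k → R k + V k) _) (cong (_+ ∑ (upTo (suc d)) (λ k → ∑ (upTo k) (T k))) (∑-+ (upTo (suc d)) R V)) ⟩
    ∑ (upTo (suc d)) R + ∑ (upTo (suc d)) V + ∑ (upTo (suc d)) (λ k → ∑ (upTo k) (T k))
      ≡⟨ ℤₚ.+-assoc (∑ (upTo (suc d)) R) _ _ ⟩
    ∑ (upTo (suc d)) R + (∑ (upTo (suc d)) V + ∑ (upTo (suc d)) (λ k → ∑ (upTo k) (T k)))
      ≡⟨ +-congˡ (∑ (upTo (suc d)) R) (begin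
           ∑ (upTo (suc d)) V + ∑ (upTo (suc d)) (λ k → ∑ (upTo k) (T k))
             -- The system produces its lower terms row by row; collected by column j they are the
             -- sum in `D-rec`.
             ≡⟨ +-congˡ (∑ (upTo (suc d)) V) (∑-triangle d T) ⟩
           ∑ (upTo (suc d)) V + ∑ (upTo (suc d)) (λ j → ∑ (range (suc j) d) (λ k → T k j))
             ≡⟨ ∑-+ (upTo (suc d)) V _ ⟨
           ∑ (upTo (suc d)) (λ j → V j + ∑ (range (suc j) d) (λ k → T k j))
             ≡⟨ ∑-upTo-cong (suc d) (λ j j< → D-rec (ℕₚ.≤-pred j<) (U (suc j)) m) ⟨
           ∑ (upTo (suc d)) (λ j → D (suc j) (U (suc j)) m) ∎) ⟩
    ∑ (upTo (suc d)) R + ∑ (upTo (suc d)) (λ j → D (suc j) (U (suc j)) m) ∎)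
    where
    R = λ k → P k * shift k (D k δ) m
    V = λ k → D k (U (suc k)) m
    T = λ k j → w k j * D k (shift (k ∸ j) (U (suc j))) m

  -- The links of a chain are non-overlapping intervals between j and d, so its total is at most d -
  -- j. The exponent `a` collects the lengths of the links already removed.
  chainOp-degree : ∀ f a {j i} → j ≤ d → d ℕ.+ a < j ℕ.+ i → chainOp f j (shift a δ) i ≡ + 0
  chainOp-degree f a {j} {i} j≤d big = go f
    where
    a<i : a < i
    a<i = ℕₚ.+-cancelˡ-< d a i (ℕₚ.<-≤-trans big (ℕₚ.+-monoˡ-≤ i j≤d))
    go : ∀ f → chainOp f j (shift a δ) i ≡ + 0
    go zero    = trans (chainOp-0 j (shift a δ) i) (shift-δ-> a<i)
    go (suc f) = begin
      chainOp (suc f) j (shift a δ) i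
        ≡⟨ chainOp-unfold f j (shift a δ) i ⟩
      shift a δ i + ∑ (range j d) (λ s → ∑ (range (suc s) d) (λ t → - w t s * chainOp f t (shift (t ∸ s) (shift a δ)) i))
        ≡⟨ cong₂ _+_ (shift-δ-> a<i)
             (trans (∑-range-cong λ s j≤s _ → trans (∑-range-cong λ t s<t t≤d → vanish s t j≤s s<t t≤d) (∑-zero (range (suc s) d)))
                    (∑-zero (range j d))) ⟩
      + 0 ∎
      where
      vanish : ∀ s t → j ≤ s → s < t → t ≤ d → - w t s * chainOp f t (shift (t ∸ s) (shift a δ)) i ≡ + 0
      vanish s t j≤s s<t t≤d = trans (cong (- w t s *_) (trans
        (chainOp-cong f t i (shift-shift (t ∸ s) a δ))
        (chainOp-degree f (t ∸ s ℕ.+ a) t≤d big′))) (ℤₚ.*-zeroʳ (- w t s))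
        where
        big′ : d ℕ.+ (t ∸ s ℕ.+ a) < t ℕ.+ i
        big′ = ℕₚ.≤-trans (s≤s (ℕₚ.≤-reflexive eq₁)) (ℕₚ.≤-trans (ℕₚ.+-monoʳ-< (t ∸ s) (ℕₚ.<-≤-trans big (ℕₚ.+-monoˡ-≤ i j≤s))) (ℕₚ.≤-reflexive eq₂))
          where
          eq₁ : d ℕ.+ (t ∸ s ℕ.+ a) ≡ t ∸ s ℕ.+ (d ℕ.+ a)
          eq₁ = begin
            d ℕ.+ (t ∸ s ℕ.+ a)   ≡⟨ ℕₚ.+-assoc d (t ∸ s) a ⟨
            d ℕ.+ (t ∸ s) ℕ.+ a   ≡⟨ cong (ℕ._+ a) (ℕₚ.+-comm d (t ∸ s)) ⟩
            t ∸ s ℕ.+ d ℕ.+ a     ≡⟨ ℕₚ.+-assoc (t ∸ s) d a ⟩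
            t ∸ s ℕ.+ (d ℕ.+ a)   ∎
          eq₂ : t ∸ s ℕ.+ (s ℕ.+ i) ≡ t ℕ.+ i
          eq₂ = trans (sym (ℕₚ.+-assoc (t ∸ s) s i)) (cong (ℕ._+ i) (ℕₚ.m∸n+n≡m (ℕₚ.<⇒≤ s<t)))

  D-degree : ∀ {j i} → j ≤ d → d < j ℕ.+ i → D j δ i ≡ + 0
  D-degree {j} {i} j≤d big = chainOp-degree (suc d) 0 j≤d (subst (_< j ℕ.+ i) (sym (ℕₚ.+-identityʳ d)) big)

  -- Links have positive length, so only the empty chain reaches the constant term.
  D-constant : ∀ j → D j δ 0 ≡ + 1
  D-constant j = begin
    D j δ 0
      ≡⟨ chainOp-unfold d j δ 0 ⟩
    + 1 + ∑ (range j d) (λ s → ∑ (range (suc s) d) (λ t → - w t s * chainOp d t (shift (t ∸ s) δ) 0))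
      ≡⟨ +-congˡ (+ 1) (trans (∑-cong (range j d) λ s → trans (∑-range-cong λ t s<t _ → vanish s t s<t) (∑-zero (range (suc s) d))) (∑-zero (range j d))) ⟩
    + 1 ∎
    where
    vanish : ∀ s t → s < t → - w t s * chainOp d t (shift (t ∸ s) δ) 0 ≡ + 0
    vanish s t s<t = trans (cong (- w t s *_) (trans (chainOp-shift d t (t ∸ s) δ 0)
      (shift-< (chainOp d t δ) (ℕₚ.m<n⇒0<n∸m s<t)))) (ℤₚ.*-zeroʳ (- w t s))

  -- The value 1 prescribed for i = j is the weight of the empty chain, which the sum for i ≠ j
  -- leaves out.
  M≡D : ∀ {i j} → j ≤ i → M i j ≡ D j δ (i ∸ j)
  M≡D {i} {j} j≤i with i ℕₚ.≟ j
  ... | yes refl rewrite ≡ᵇ-refl i | ℕₚ.n∸n≡0 i = sym (D-constant i)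
  ... | no i≢j rewrite ≢⇒≡ᵇ-false i≢j = trans (sym (∑-unfold (chains (suc d) j) _)) (∑-cong (chains (suc d) j) (term (i ∸ j) (ℕₚ.m<n⇒0<n∸m (ℕₚ.≤∧≢⇒< j≤i (i≢j ∘ sym)))))
    where
    choose : ∀ b x → (if b then x else + 0) ≡ x * ⟦ b ⟧
    choose true  x = sym (ℤₚ.*-identityʳ x)
    choose false x = sym (ℤₚ.*-zeroʳ x)
    term : ∀ e → 0 < e → ∀ c → (if nonEmpty c ∧ (total c ≡ᵇ e) then weight c else + 0) ≡ weight c * shift (total c) δ e
    -- The empty chain may be put back: its series is 1, with coefficient 0 in positive degree.
    term (suc e) _ []        = refl
    term e       _ c@(_ ∷ _) = trans (choose (total c ≡ᵇ e) (weight c)) (cong (weight c *_) (sym (shift-δ (total c) e)))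

  denCoeff≡D : ∀ i → denCoeff i ≡ D 0 δ i
  denCoeff≡D i with i ℕₚ.≤? d
  ... | yes i≤d rewrite dec-true (i ℕₚ.≤? d) i≤d = M≡D z≤n
  ... | no i≰d rewrite dec-false (i ℕₚ.≤? d) i≰d = sym (D-degree z≤n (ℕₚ.≰⇒> i≰d))

  denCoeff-convolution : ∀ (X : Series) m → (denCoeff *ₛ X) m ≡ D 0 X m
  denCoeff-convolution X m = begin
    (denCoeff *ₛ X) m
      ≡⟨ ∑-unfold (range 0 m) _ ⟨
    ∑ (range 0 m) (λ i → denCoeff i * X (m ∸ i))
      ≡⟨ ∑-range 0 m _ ⟩
    ∑ (upTo (suc m)) (λ i → denCoeff i * X (m ∸ i))
      ≡⟨ ∑-cong (upTo (suc m)) (λ i → trans (cong (_* X (m ∸ i)) (denCoeff≡D i)) (sym (∑-*ʳ (chains (suc d) 0) (X (m ∸ i)) _))) ⟩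
    ∑ (upTo (suc m)) (λ i → ∑ (chains (suc d) 0) (λ c → weight c * shift (total c) δ i * X (m ∸ i)))
      ≡⟨ ∑-comm (upTo (suc m)) (chains (suc d) 0) _ ⟩
    ∑ (chains (suc d) 0) (λ c → ∑ (upTo (suc m)) (λ i → weight c * shift (total c) δ i * X (m ∸ i)))
      ≡⟨ ∑-cong (chains (suc d) 0) (λ c → begin
           ∑ (upTo (suc m)) (λ i → weight c * shift (total c) δ i * X (m ∸ i))
             ≡⟨ ∑-cong (upTo (suc m)) (λ i → ℤₚ.*-assoc (weight c) _ _) ⟩
           ∑ (upTo (suc m)) (λ i → weight c * (shift (total c) δ i * X (m ∸ i)))
             ≡⟨ ∑-*ˡ (upTo (suc m)) (weight c) _ ⟩
           weight c * ∑ (upTo (suc m)) (λ i → shift (total c) δ i * X (m ∸ i))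
             ≡⟨ cong (weight c *_) (shift-convolution (total c) X m) ⟨
           weight c * shift (total c) X m ∎) ⟩
    D 0 X m ∎

  -- The degree of zᵏ D k is at most k + (d - k) = d, in agreement with the cut-off in `numCoeff`;
  -- for m ≤ d the terms with k > m have no coefficient at zᵐ.
  numCoeff≡D : ∀ m → numCoeff m ≡ ∑ (upTo (suc d)) (λ k → P k * shift k (D k δ) m)
  numCoeff≡D m with m ℕₚ.≤? d
  ... | yes m≤d rewrite dec-true (m ℕₚ.≤? d) m≤d = begin
    sumℤ (map (λ j → P j * M m j) (range 0 m))
      ≡⟨ ∑-unfold (range 0 m) _ ⟨
    ∑ (range 0 m) (λ j → P j * M m j)
      ≡⟨ ∑-range 0 m _ ⟩
    ∑ (upTo (suc m)) (λ j → P j * M m j)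
      ≡⟨ ∑-upTo-cong (suc m) (λ j j< → cong (P j *_) (trans (M≡D (ℕₚ.≤-pred j<)) (sym (shift-≤ (D j δ) (ℕₚ.≤-pred j<))))) ⟩
    ∑ (upTo (suc m)) (λ j → P j * shift j (D j δ) m)
      ≡⟨ ∑-upTo-truncate _ (s≤s m≤d) (λ i m<i → trans (cong (P i *_) (shift-< (D i δ) m<i)) (ℤₚ.*-zeroʳ (P i))) ⟨
    ∑ (upTo (suc d)) (λ k → P k * shift k (D k δ) m) ∎
  ... | no m≰d rewrite dec-false (m ℕₚ.≤? d) m≰d = sym (trans
    (∑-upTo-cong (suc d) {g = λ _ → + 0} λ k k< → vanish k (ℕₚ.≤-pred k<)) (∑-zero (upTo (suc d))))
    where
    vanish : ∀ k → k ≤ d → P k * shift k (D k δ) m ≡ + 0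
    vanish k k≤d = trans (cong (P k *_) (trans (shift-≤ (D k δ) k≤m) (D-degree k≤d
      (subst (d <_) (sym (ℕₚ.m+[n∸m]≡n k≤m)) (ℕₚ.≰⇒> m≰d))))) (ℤₚ.*-zeroʳ (P k))
      where
      k≤m = ℕₚ.≤-trans k≤d (ℕₚ.<⇒≤ (ℕₚ.≰⇒> m≰d))

  generating-identity : ℓ d ≡ 0 → ∀ m → (denCoeff *ₛ (λ i → extensions ℓℤ i 0)) m ≡ numCoeff m
  generating-identity ℓd≡0 m = begin
    (denCoeff *ₛ (λ i → extensions ℓℤ i 0)) m                        ≡⟨ denCoeff-convolution (λ i → extensions ℓℤ i 0) m ⟩
    D 0 (λ i → extensions ℓℤ i 0) m                                  ≡⟨ chainOp-cong (suc d) 0 m (λ i → sym (ℤₚ.*-identityˡ (extensions ℓℤ i 0))) ⟩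
    D 0 (U 0) m                                          ≡⟨ D-U-telescope ℓd≡0 m ⟩
    ∑ (upTo (suc d)) (λ k → P k * shift k (D k δ) m)     ≡⟨ numCoeff≡D m ⟨
    numCoeff m                                           ∎

-- From the number of geodesics to the identity of series

GeodesicCount≡ : ∀ Γ {m k} → GeodesicCount Γ m k → k ≡ length (Words.reducedWords Γ m)
GeodesicCount≡ Γ {m} (L , uniq , mem , len) = trans (sym len)
  (↭-length (∼bag⇒↭ (unique∧set⇒bag uniq (Words.reducedWords-unique Γ m)
    λ {w} → ⇔.trans (mem w) (⇔.sym (Words.reducedWords⇔ Γ m w)))))

*ₛ-congʳ : ∀ f {g h : Series} → (∀ i → g i ≡ h i) → ∀ m → (f *ₛ g) m ≡ (f *ₛ h) m
*ₛ-congʳ f {g} {h} g≡h m = begin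
  (f *ₛ g) m                               ≡⟨ ∑-unfold (range 0 m) _ ⟨
  ∑ (range 0 m) (λ i → f i * g (m ∸ i))    ≡⟨ ∑-cong (range 0 m) (λ i → cong (f i *_) (g≡h (m ∸ i))) ⟩
  ∑ (range 0 m) (λ i → f i * h (m ∸ i))    ≡⟨ ∑-unfold (range 0 m) _ ⟩
  (f *ₛ h) m                               ∎

theorem6p4 : (Γ : SimpleGraph) → LinkRegular Γ →
    (d : ℕ) → MaxCliqueSize Γ d →
    (ℓ : ℕ → ℕ) → ℓ 0 ≡ SimpleGraph.n Γ →
    (∀ k → 1 ≤ k → k ≤ d → ∀ σ → IsClique Γ σ → ∣ σ ∣ ≡ k → ∣ Lk Γ σ ∣ ≡ ℓ k) →
    (a : ℕ → ℕ) → (∀ m → GeodesicCount Γ m (a m)) →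
    ∀ m → (Numbers.denCoeff ℓ d *ₛ (λ i → Data.Integer.+_ (a i))) m ≡ Numbers.numCoeff ℓ d m
theorem6p4 Γ _ d maxClique ℓ ℓ0≡n linkSize a count m = trans
  (*ₛ-congʳ (Numbers.denCoeff ℓ d)
    (λ i → trans (cong +_ (GeodesicCount≡ Γ (count i))) (length-reducedWords i)) m)
  (Generating.generating-identity ℓ d ℓd≡0 m)
  where open Cliques.LinkSizes Γ d maxClique ℓ ℓ0≡n linkSize
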